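{- Let $k\mathrm{AND}=f_{\{k\},k}:\{ -1,1\}^k\to\{0,1\}$ be the function which is $1$ exactly on the all-ones vector, and let $\rho(k\mathrm{AND})=\Pr_{\mathbf b\sim\mathrm{Unif}(\{ -1,1\}^k)}[k\mathrm{AND}(\mathbf b)=1]=2^{ -k}$. Then $\lim_{k\to\infty}\frac{\alpha(k\mathrm{AND})}{2\rho(k\mathrm{AND})}=1$.
   Context: For $\mathbf b\in\{ -1,1\}^k$, $\mathrm{wt}(\mathbf b)$ is the number of coordinates equal to $1$. For nonempty $S\subseteq[k]=\{1,\dots,k\}$, $f_{S,k}:\{ -1,1\}^k\to\{0,1\}$ is given by $f_{S,k}(\mathbf x)=1$ iff $\mathrm{wt}(\mathbf x)\in S$. $\Delta_k$ is the set of symmetric probability distributions $\mathcal D$ on $\{ -1,1\}^k$ (vectors of equal weight are equiprobable). $\mathrm{Bern}(p)$ is the random variable equal to $1$ with probability $p$ and $-1$ with probability $1-p$; $\odot$ is the coordinatewise product. For $\mathcal D\in\Delta_k$ and $p\in[0,1]$ define $$\lambda_S(\mathcal D,p)=\mathbb E_{\mathbf a\sim\mathcal D,\ \mathbf b\sim \mathrm{Bern}(p)^k}[f_{S,k}(\mathbf a\odot\mathbf b)],\quad \mu(\mathcal D)=\mathbb E_{\mathbf b\sim\mathcal D}[b_1],\quad \beta_S(\mathcal D)=\sup_{p\in[0,1]}\lambda_S(\mathcal D,p),\quad \gamma_S(\mathcal D)=\lambda_S(\mathcal D,1).$$ The (sketching approximation) ratio of $f_{S,k}$ is $$\alpha(f_{S,k})=\inf_{\mathcal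 D_N,\mathcal D_Y\in\Delta_k:\ \mu(\mathcal D_N)=\mu(\mathcal D_Y)}\frac{\beta_S(\mathcal D_N)}{\gamma_S(\mathcal D_Y)},$$ where the ratio is $+\infty$ if $\gamma_S(\mathcal D_Y)=0$. -}

module Defs where

open import Level using (0ℓ)
open import Data.Bool using (if_then_else_)
open import Data.Empty using (⊥)
open import Data.Integer using (+_)
open import Data.List using (List)
open import Data.List.Membership.DecPropositional using (_∈?_)
open import Data.Nat as ℕ using (ℕ; zero; suc)
import Data.Nat.Properties as ℕ
open import Data.Product using (∃-syntax; Σ-syntax; _×_; _,_)
open import Data.Rational as ℚ using (ℚ; 0ℚ; 1ℚ; ½)
import Data.Rational.Properties as ℚ
open import Data.Rational.Solver using (module +-*-Solver)
open import Data.Sign as Sign using (Sign)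
open import Data.Sum using (inj₁; inj₂)
open import Data.Unit using (⊤)
open import Data.Vec using (Vec; []; _∷_; head; zipWith)
open import Relation.Binary.Core using (Rel)
open import Relation.Binary.PropositionalEquality
  using (_≡_; refl; sym; trans; cong; cong₂; subst; subst₂)
open import Relation.Nullary using (does)
open import Relation.Unary using (Pred)
open +-*-Solver using (solve; _:+_; _:*_; :-_; _:-_; _:=_; con)

------------------------------------------------------------------------
-- Real numbers: Cauchy sequences of rationals, compared up to the setoid
-- equality _≈_.

record ℝ : Set where
  constructor mkℝ
  field
    seq    : ℕ → ℚ
    cauchy : ∀ ε → 0ℚ ℚ.< ε →
             ∃[ N ] (∀ m n → N ℕ.≤ m → N ℕ.≤ n → ℚ.∣ seq m ℚ.- seq n ∣ ℚ.< ε)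
open ℝ public

infix 4 _≈_ _≤_ _<_

_≈_ _≤_ _<_ : Rel ℝ 0ℓ
x ≈ y = ∀ ε → 0ℚ ℚ.< ε → ∃[ N ] (∀ n → N ℕ.≤ n → ℚ.∣ seq x n ℚ.- seq y n ∣ ℚ.< ε)
x ≤ y = ∀ ε → 0ℚ ℚ.< ε → ∃[ N ] (∀ n → N ℕ.≤ n → seq x n ℚ.< seq y n ℚ.+ ε)
x < y = ∃[ ε ] (0ℚ ℚ.< ε × ∃[ N ] (∀ n → N ℕ.≤ n → seq x n ℚ.+ ε ℚ.< seq y n))

fromℚ : ℚ → ℝ
fromℚ q = mkℝ (λ _ → q) λ ε 0<ε →
  0 , λ _ _ _ _ → subst (ℚ._< ε) (sym (cong ℚ.∣_∣ (ℚ.+-inverseʳ q))) 0<ε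

0ℝ 1ℝ 2ℝ : ℝ
0ℝ = fromℚ 0ℚ
1ℝ = fromℚ 1ℚ
2ℝ = fromℚ (+ 2 ℚ./ 1)

private
  half-pos : ∀ {ε} → 0ℚ ℚ.< ε → 0ℚ ℚ.< ½ ℚ.* ε
  half-pos {ε} 0<ε =
    subst (ℚ._< ½ ℚ.* ε) (ℚ.*-zeroʳ ½) (ℚ.*-monoʳ-<-pos ½ 0<ε)

  halves : ∀ ε → ½ ℚ.* ε ℚ.+ ½ ℚ.* ε ≡ ε
  halves ε = trans (sym (ℚ.*-distribʳ-+ ε ½ ½)) (ℚ.*-identityˡ ε)

  ∣∣-comm : ∀ p q → ℚ.∣ p ℚ.- q ∣ ≡ ℚ.∣ q ℚ.- p ∣
  ∣∣-comm p q = trans (sym (ℚ.∣-p∣≡∣p∣ (p ℚ.- q)))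
    (cong ℚ.∣_∣ (solve 2 (λ p q → :- (p :- q) := q :- p) refl p q))

  ∣p∣-∣q∣≤∣p-q∣ : ∀ p q → ℚ.∣ p ∣ ℚ.- ℚ.∣ q ∣ ℚ.≤ ℚ.∣ p ℚ.- q ∣
  ∣p∣-∣q∣≤∣p-q∣ p q = subst (ℚ.∣ p ∣ ℚ.- ℚ.∣ q ∣ ℚ.≤_)
    (solve 2 (λ u v → (u :+ v) :- v := u) refl ℚ.∣ p ℚ.- q ∣ ℚ.∣ q ∣)
    (ℚ.+-monoˡ-≤ (ℚ.- ℚ.∣ q ∣)
      (subst (λ r → ℚ.∣ r ∣ ℚ.≤ ℚ.∣ p ℚ.- q ∣ ℚ.+ ℚ.∣ q ∣)
        (solve 2 (λ p q → (p :- q) :+ q := p) refl p q)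
        (ℚ.∣p+q∣≤∣p∣+∣q∣ (p ℚ.- q) q)))

  ∣∣p∣-∣q∣∣≤∣p-q∣ : ∀ p q → ℚ.∣ ℚ.∣ p ∣ ℚ.- ℚ.∣ q ∣ ∣ ℚ.≤ ℚ.∣ p ℚ.- q ∣
  ∣∣p∣-∣q∣∣≤∣p-q∣ p q with ℚ.∣p∣≡p∨∣p∣≡-p (ℚ.∣ p ∣ ℚ.- ℚ.∣ q ∣)
  ... | inj₁ eq = subst (ℚ._≤ ℚ.∣ p ℚ.- q ∣) (sym eq) (∣p∣-∣q∣≤∣p-q∣ p q)
  ... | inj₂ eq = subst₂ ℚ._≤_
    (sym (trans eq (solve 2 (λ u v → :- (u :- v) := v :- u) refl ℚ.∣ p ∣ ℚ.∣ q ∣)))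
    (∣∣-comm q p) (∣p∣-∣q∣≤∣p-q∣ q p)

  bounded : (x : ℝ) →
    ∃[ B ] (0ℚ ℚ.< B × ∃[ N ] (∀ n → N ℕ.≤ n → ℚ.∣ seq x n ∣ ℚ.< B))
  bounded x with cauchy x 1ℚ (ℚ.positive⁻¹ 1ℚ)
  ... | N , h = B , 0<B , N , bd
    where
    c = ℚ.∣ seq x N ∣
    B = 1ℚ ℚ.+ c
    0<B : 0ℚ ℚ.< B
    0<B = ℚ.+-mono-<-≤ (ℚ.positive⁻¹ 1ℚ) (ℚ.0≤∣p∣ (seq x N))
    bd : ∀ n → N ℕ.≤ n → ℚ.∣ seq x n ∣ ℚ.< B
    bd n N≤n = ℚ.≤-<-trans
      (subst (λ r → ℚ.∣ r ∣ ℚ.≤ ℚ.∣ seq x n ℚ.- seq x N ∣ ℚ.+ c)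
        (solve 2 (λ p q → (p :- q) :+ q := p) refl (seq x n) (seq x N))
        (ℚ.∣p+q∣≤∣p∣+∣q∣ (seq x n ℚ.- seq x N) (seq x N)))
      (ℚ.+-monoˡ-< c (h n N N≤n ℕ.≤-refl))

  -- For ε, B > 0 there is δ > 0 with B δ = ε.
  divide : ∀ ε B → 0ℚ ℚ.< ε → 0ℚ ℚ.< B → ∃[ δ ] (0ℚ ℚ.< δ × B ℚ.* δ ≡ ε)
  divide ε B 0<ε 0<B = 1/B ℚ.* ε , 0<δ ,
    trans (sym (ℚ.*-assoc B 1/B ε))
      (trans (cong (ℚ._* ε) (ℚ.*-inverseʳ B)) (ℚ.*-identityˡ ε))
    where
    instance
      B-pos : ℚ.Positive B
      B-pos = ℚ.positive 0<B
      B-nz : ℚ.NonZero B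
      B-nz = ℚ.pos⇒nonZero B
    1/B = ℚ.1/ B
    instance
      1/B-pos : ℚ.Positive 1/B
      1/B-pos = ℚ.1/pos⇒pos B
    0<δ : 0ℚ ℚ.< 1/B ℚ.* ε
    0<δ = subst (ℚ._< 1/B ℚ.* ε) (ℚ.*-zeroʳ 1/B) (ℚ.*-monoʳ-<-pos 1/B 0<ε)

  ∣*∣-bound : ∀ {B δ} u v → 0ℚ ℚ.< B → ℚ.∣ u ∣ ℚ.< B → ℚ.∣ v ∣ ℚ.< δ →
              ℚ.∣ u ℚ.* v ∣ ℚ.≤ B ℚ.* δ
  ∣*∣-bound {B} {δ} u v 0<B u<B v<δ =
    subst (ℚ._≤ B ℚ.* δ) (sym (ℚ.∣p*q∣≡∣p∣*∣q∣ u v))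
      (ℚ.≤-trans
        (ℚ.*-monoʳ-≤-nonNeg ℚ.∣ v ∣ {{ℚ.∣-∣-nonNeg v}} (ℚ.<⇒≤ u<B))
        (ℚ.*-monoˡ-≤-nonNeg B {{ℚ.nonNegative (ℚ.<⇒≤ 0<B)}} (ℚ.<⇒≤ v<δ)))

infix  8 -_
infixl 7 _*_
infixl 6 _+_ _-_

_+_ : ℝ → ℝ → ℝ
x + y = mkℝ (λ n → seq x n ℚ.+ seq y n) λ ε 0<ε →
  let Nx , hx = cauchy x (½ ℚ.* ε) (half-pos 0<ε)
      Ny , hy = cauchy y (½ ℚ.* ε) (half-pos 0<ε)
  in Nx ℕ.⊔ Ny , λ m n N≤m N≤n → ℚ.≤-<-trans
       (subst (λ r → ℚ.∣ r ∣ ℚ.≤ ℚ.∣ seq x m ℚ.- seq x n ∣ ℚ.+ ℚ.∣ seq y m ℚ.- seq y n ∣)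
         (solve 4 (λ a b c d → (a :- b) :+ (c :- d) := (a :+ c) :- (b :+ d)) refl
           (seq x m) (seq x n) (seq y m) (seq y n))
         (ℚ.∣p+q∣≤∣p∣+∣q∣ (seq x m ℚ.- seq x n) (seq y m ℚ.- seq y n)))
       (subst (ℚ.∣ seq x m ℚ.- seq x n ∣ ℚ.+ ℚ.∣ seq y m ℚ.- seq y n ∣ ℚ.<_) (halves ε)
         (ℚ.+-mono-<
           (hx m n (ℕ.m⊔n≤o⇒m≤o Nx Ny N≤m) (ℕ.m⊔n≤o⇒m≤o Nx Ny N≤n))
           (hy m n (ℕ.m⊔n≤o⇒n≤o Nx Ny N≤m) (ℕ.m⊔n≤o⇒n≤o Nx Ny N≤n))))

-_ : ℝ → ℝ
- x = mkℝ (λ n → ℚ.- seq x n) λ ε 0<ε →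
  let N , h = cauchy x ε 0<ε
  in N , λ m n N≤m N≤n → subst (ℚ._< ε)
       (trans (∣∣-comm (seq x m) (seq x n))
         (cong ℚ.∣_∣ (solve 2 (λ a b → b :- a := (:- a) :- (:- b)) refl (seq x m) (seq x n))))
       (h m n N≤m N≤n)

_-_ : ℝ → ℝ → ℝ
x - y = x + (- y)

_*_ : ℝ → ℝ → ℝ
x * y = mkℝ (λ n → seq x n ℚ.* seq y n) λ ε 0<ε →
  let A , 0<A , NA , hA = bounded x
      B , 0<B , NB , hB = bounded y
      ε/2 = ½ ℚ.* ε
      δ , 0<δ , Aδ = divide (½ ℚ.* ε/2) A (half-pos (half-pos 0<ε)) 0<A
      η , 0<η , Bη = divide (½ ℚ.* ε/2) B (half-pos (half-pos 0<ε)) 0<B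
      Ny , hy = cauchy y δ 0<δ
      Nx , hx = cauchy x η 0<η
      N₁ = NA ℕ.⊔ NB
      N₂ = Nx ℕ.⊔ Ny
  in N₁ ℕ.⊔ N₂ , λ m n N≤m N≤n →
      let N₁≤m = ℕ.m⊔n≤o⇒m≤o N₁ N₂ N≤m
          N₁≤n = ℕ.m⊔n≤o⇒m≤o N₁ N₂ N≤n
          N₂≤m = ℕ.m⊔n≤o⇒n≤o N₁ N₂ N≤m
          N₂≤n = ℕ.m⊔n≤o⇒n≤o N₁ N₂ N≤n
          a = seq x m ; a′ = seq x n ; b = seq y m ; b′ = seq y n
          T₁ = ∣*∣-bound a (b ℚ.- b′) 0<A (hA m (ℕ.m⊔n≤o⇒m≤o NA NB N₁≤m))
                 (hy m n (ℕ.m⊔n≤o⇒n≤o Nx Ny N₂≤m) (ℕ.m⊔n≤o⇒n≤o Nx Ny N₂≤n))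
          T₂ = ∣*∣-bound b′ (a ℚ.- a′) 0<B (hB n (ℕ.m⊔n≤o⇒n≤o NA NB N₁≤n))
                 (hx m n (ℕ.m⊔n≤o⇒m≤o Nx Ny N₂≤m) (ℕ.m⊔n≤o⇒m≤o Nx Ny N₂≤n))
      in ℚ.≤-<-trans
           (subst (λ r → ℚ.∣ r ∣ ℚ.≤ ε/2)
             (solve 4 (λ a a′ b b′ →
                 a :* (b :- b′) :+ b′ :* (a :- a′) := a :* b :- a′ :* b′)
               refl a a′ b b′)
             (ℚ.≤-trans
               (ℚ.∣p+q∣≤∣p∣+∣q∣ (a ℚ.* (b ℚ.- b′)) (b′ ℚ.* (a ℚ.- a′)))
               (subst (ℚ.∣ a ℚ.* (b ℚ.- b′) ∣ ℚ.+ ℚ.∣ b′ ℚ.* (a ℚ.- a′) ∣ ℚ.≤_)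
                 (trans (cong₂ ℚ._+_ Aδ Bη) (halves ε/2))
                 (ℚ.+-mono-≤ T₁ T₂))))
           (subst₂ ℚ._<_ (ℚ.+-identityʳ ε/2) (halves ε)
             (ℚ.+-monoʳ-< ε/2 (half-pos 0<ε)))

∣_∣ : ℝ → ℝ
∣ x ∣ = mkℝ (λ n → ℚ.∣ seq x n ∣) λ ε 0<ε →
  let N , h = cauchy x ε 0<ε
  in N , λ m n N≤m N≤n →
       ℚ.≤-<-trans (∣∣p∣-∣q∣∣≤∣p-q∣ (seq x m) (seq x n)) (h m n N≤m N≤n)

infix 4 _⟶_

_⟶_ : (ℕ → ℝ) → ℝ → Set
a ⟶ ℓ = ∀ ε → 0ℝ < ε → ∃[ N ] (∀ n → N ℕ.≤ n → ∣ a n - ℓ ∣ < ε)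

-- ℝ with a top element.
data ℝ∞ : Set where
  fin : ℝ → ℝ∞
  ∞   : ℝ∞

infix 4 _≤∞_

_≤∞_ : Rel ℝ∞ 0ℓ
_     ≤∞ ∞     = ⊤
∞     ≤∞ fin _ = ⊥
fin x ≤∞ fin y = x ≤ y

-- IsQuotient x y r: r is the value of x / y for y ≥ 0, where x / 0 = ∞.
IsQuotient : ℝ → ℝ → ℝ∞ → Set
IsQuotient x y (fin r) = 0ℝ < y × r * y ≈ x
IsQuotient x y ∞       = y ≈ 0ℝ

IsSup : Pred ℝ 0ℓ → ℝ → Set
IsSup P s = (∀ x → P x → x ≤ s) × (∀ u → (∀ x → P x → x ≤ u) → s ≤ u)

IsInf : Pred ℝ∞ 0ℓ → ℝ∞ → Set
IsInf P i = (∀ x → P x → i ≤∞ x) × (∀ l → (∀ x → P x → l ≤∞ x) → l ≤∞ i)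

------------------------------------------------------------------------
-- The cube {-1,1}^k, as vectors of signs.

Cube : ℕ → Set
Cube = Vec Sign

infixl 7 _⊙_

_⊙_ : ∀ {k} → Cube k → Cube k → Cube k
_⊙_ = zipWith Sign._*_

wt : ∀ {k} → Cube k → ℕ
wt []           = 0
wt (Sign.+ ∷ x) = suc (wt x)
wt (Sign.- ∷ x) = wt x

sgn : Sign → ℝ
sgn Sign.+ = 1ℝ
sgn Sign.- = - 1ℝ

-- S ⊆ {1,…,k} is given by a list of its elements; kAND is f [ k ] on Cube k.
f : ∀ {k} → List ℕ → Cube k → ℝ
f S x = if does (_∈?_ ℕ._≟_ (wt x) S) then 1ℝ else 0ℝ

sumCube : ∀ {k} → (Cube k → ℝ) → ℝ
sumCube {zero}  g = g []
sumCube {suc k} g = sumCube (λ x → g (Sign.+ ∷ x)) + sumCube (λ x → g (Sign.- ∷ x))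

-- Expectation of g under the probability mass function w.
𝔼 : ∀ {k} → (Cube k → ℝ) → (Cube k → ℝ) → ℝ
𝔼 w g = sumCube (λ x → w x * g x)

-- Mass function of Bern(p)^k.
bern : ℝ → ∀ {k} → Cube k → ℝ
bern p []           = 1ℝ
bern p (Sign.+ ∷ x) = p * bern p x
bern p (Sign.- ∷ x) = (1ℝ - p) * bern p x

unif : ∀ {k} → Cube k → ℝ
unif {k} _ = fromℚ (ℚ._/_ (+ 1) (2 ℕ.^ k) {{ℕ.m^n≢0 2 k}})

record Δ (k : ℕ) : Set where
  field
    mass      : Cube k → ℝ
    nonneg    : ∀ x → 0ℝ ≤ mass x
    total     : sumCube mass ≈ 1ℝ
    symmetric : ∀ x y → wt x ≡ wt y → mass x ≈ mass y
open Δ public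

lam : ∀ {k} → List ℕ → Δ k → ℝ → ℝ
lam S D p = 𝔼 (mass D) λ a → 𝔼 (bern p) λ b → f S (a ⊙ b)

μ : ∀ {k} .{{_ : ℕ.NonZero k}} → Δ k → ℝ
μ {suc _} D = 𝔼 (mass D) λ b → sgn (head b)

-- IsBeta S D b: b = β_S(D).
IsBeta : ∀ {k} → List ℕ → Δ k → ℝ → Set
IsBeta S D = IsSup λ x → ∃[ p ] (0ℝ ≤ p × p ≤ 1ℝ × x ≈ lam S D p)

γ : ∀ {k} → List ℕ → Δ k → ℝ
γ S D = lam S D 1ℝ

-- IsAlpha k S a: a = α(f_{S,k}).
IsAlpha : ∀ k .{{_ : ℕ.NonZero k}} → List ℕ → ℝ∞ → Set
IsAlpha k S = IsInf λ r →
  Σ[ DN ∈ Δ k ] Σ[ DY ∈ Δ k ] (μ DN ≈ μ DY ×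
    ∃[ b ] (IsBeta S DN b × IsQuotient b (γ S DY) r))

ρ : ℕ → List ℕ → ℝ
ρ k S = 𝔼 {k} unif (f S)

{-# OPTIONS --safe #-}
-- Write x = 1/k and A(D) for the mass D gives to vectors with first coordinate 1, so
-- μ(D) = 2 A(D) - 1 and, by symmetry, A(D) is also the mean of wt/k under D.
--
-- Lower bound: for kAND, λ(D,p) = E_D[p^wt (1-p)^(k-wt)].  At the single value p = (1+x)/2,
-- cancelling pairs (1+x)(1-x) = 1-x² and applying Bernoulli's inequality gives
-- 2^k p^i (1-p)^(k-i) ≥ (1-x) 2i/k for every i, whence
-- β(D_N) ≥ (1-x) 2^(1-k) A(D_N) = (1-x) 2^(1-k) A(D_Y) ≥ (1-x) 2^(1-k) γ(D_Y).
--
-- Upper bound: if D_N is uniform then λ(D_N,p) = 2^-k for all p, and the D_Y that is uniform on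
-- the two constant vectors has the same μ and γ(D_Y) = 1/2, so α ≤ 2^(1-k).
module Submission where

open import Defs
open import Algebra.Bundles using (module CommutativeRing)
import Algebra.Definitions.RawSemiring as RawSemiring
import Algebra.Properties.CommutativeSemiring.Exp as CommutativeExp
import Algebra.Properties.Semiring.Exp as Exp
open import Data.Bool using (true; false; if_then_else_; _∨_)
open import Data.Integer as ℤ using (+_; +≤+; +[1+_])
import Data.Integer.Properties as ℤ
open import Data.List using ([_])
open import Data.List.Membership.DecPropositional using (_∈?_)
open import Data.Nat as ℕ using (ℕ; NonZero; zero; suc; z≤n; s≤s)
import Data.Nat.Properties as ℕ
open import Data.Product using (∃-syntax; Σ-syntax; _×_; _,_; proj₁; proj₂)
open import Data.Rational as ℚ using (ℚ; 0ℚ; 1ℚ; ½; mkℚ)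
import Data.Rational.Properties as ℚ
open import Data.Rational.Solver using (module +-*-Solver)
import Data.Rational.Unnormalised as ℚᵘ
import Data.Rational.Unnormalised.Properties as ℚᵘ
open import Data.Sign as Sign using (Sign)
open import Data.Sum using (inj₁; inj₂)
open import Data.Vec using ([]; _∷_; head; replicate)
open import Level using (0ℓ)
open import Relation.Binary.Bundles using (Preorder)
import Relation.Binary.Reasoning.Preorder as PreorderReasoning
open import Relation.Binary.PropositionalEquality
  using (_≡_; refl; sym; trans; cong; cong₂; subst; subst₂)
open import Relation.Nullary using (does)
open +-*-Solver using (solve; _:+_; _:*_; :-_; _:-_; _:=_; con)
open RawSemiring ℚ.+-*-rawSemiring using (_^_) renaming (_×_ to _·_)
open Exp (CommutativeRing.semiring ℚ.+-*-commutativeRing) using (^-homo-*)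
open CommutativeExp (CommutativeRing.commutativeSemiring ℚ.+-*-commutativeRing) using (^-distrib-*)

-- Rational arithmetic

-- Embedding by repeated addition, so that `⟨ suc n ⟩` unfolds to `1ℚ ℚ.+ ⟨ n ⟩` and inductive steps
-- become ring identities.
⟨_⟩ : ℕ → ℚ
⟨ n ⟩ = n · 1ℚ

-- Reduces a polynomial inequality to an explicit nonnegative surplus `r` and an identity for the
-- ring solver.
≤-by : ∀ {p q} r → 0ℚ ℚ.≤ r → q ≡ p ℚ.+ r → p ℚ.≤ q
≤-by {p} r 0≤r refl = subst (ℚ._≤ p ℚ.+ r) (ℚ.+-identityʳ p) (ℚ.+-monoʳ-≤ p 0≤r)

*-nonneg : ∀ {p q} → 0ℚ ℚ.≤ p → 0ℚ ℚ.≤ q → 0ℚ ℚ.≤ p ℚ.* q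
*-nonneg {p} {q} 0≤p 0≤q = subst (ℚ._≤ p ℚ.* q) (ℚ.*-zeroʳ p)
  (ℚ.*-monoˡ-≤-nonNeg p {{ℚ.nonNegative 0≤p}} 0≤q)

*-pos : ∀ {p q} → 0ℚ ℚ.< p → 0ℚ ℚ.< q → 0ℚ ℚ.< p ℚ.* q
*-pos {p} {q} 0<p 0<q = subst (ℚ._< p ℚ.* q) (ℚ.*-zeroʳ p)
  (ℚ.*-monoʳ-<-pos p {{ℚ.positive 0<p}} 0<q)

*-monoˡ-≤ : ∀ {p q} r → 0ℚ ℚ.≤ r → p ℚ.≤ q → r ℚ.* p ℚ.≤ r ℚ.* q
*-monoˡ-≤ r 0≤r = ℚ.*-monoˡ-≤-nonNeg r {{ℚ.nonNegative 0≤r}}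

p*p-nonneg : ∀ p → 0ℚ ℚ.≤ p ℚ.* p
p*p-nonneg p@(mkℚ (+ _) _ _) = *-nonneg {p} {p} (ℚ.nonNegative⁻¹ p) (ℚ.nonNegative⁻¹ p)
p*p-nonneg p@(mkℚ ℤ.-[1+ _ ] _ _) = ℚ.≤-trans
  (*-nonneg {ℚ.- p} {ℚ.- p} (ℚ.nonNegative⁻¹ (ℚ.- p)) (ℚ.nonNegative⁻¹ (ℚ.- p)))
  (ℚ.≤-reflexive (solve 1 (λ p → (:- p) :* (:- p) := p :* p) refl p))

p≤q⇒0≤q-p : ∀ {p q} → p ℚ.≤ q → 0ℚ ℚ.≤ q ℚ.- p
p≤q⇒0≤q-p {p} {q} p≤q = subst (ℚ._≤ q ℚ.- p) (ℚ.+-inverseʳ p) (ℚ.+-monoˡ-≤ (ℚ.- p) p≤q)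

0≤1 : 0ℚ ℚ.≤ 1ℚ
0≤1 = ℚ.nonNegative⁻¹ 1ℚ

0≤⟨_⟩ : ∀ n → 0ℚ ℚ.≤ ⟨ n ⟩
0≤⟨ zero ⟩ = ℚ.≤-refl
0≤⟨ suc n ⟩ = ℚ.+-mono-≤ 0≤1 0≤⟨ n ⟩

⟨⟩-mono-≤ : ∀ {m n} → m ℕ.≤ n → ⟨ m ⟩ ℚ.≤ ⟨ n ⟩
⟨⟩-mono-≤ {n = n} z≤n = 0≤⟨ n ⟩
⟨⟩-mono-≤ (s≤s m≤n) = ℚ.+-monoʳ-≤ 1ℚ (⟨⟩-mono-≤ m≤n)

⟨⟩-homo-+ : ∀ m n → ⟨ m ℕ.+ n ⟩ ≡ ⟨ m ⟩ ℚ.+ ⟨ n ⟩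
⟨⟩-homo-+ zero n = sym (ℚ.+-identityˡ ⟨ n ⟩)
⟨⟩-homo-+ (suc m) n = trans (cong (1ℚ ℚ.+_) (⟨⟩-homo-+ m n)) (sym (ℚ.+-assoc 1ℚ ⟨ m ⟩ ⟨ n ⟩))

toℚᵘ-⟨⟩ : ∀ n → ℚ.toℚᵘ ⟨ n ⟩ ℚᵘ.≃ ℚᵘ.mkℚᵘ (+ n) 0
toℚᵘ-⟨⟩ zero = ℚᵘ.≃-refl
toℚᵘ-⟨⟩ (suc n) = ℚᵘ.≃-trans (ℚ.toℚᵘ-homo-+ 1ℚ ⟨ n ⟩)
  (ℚᵘ.≃-trans (ℚᵘ.+-congʳ ℚᵘ.1ℚᵘ (toℚᵘ-⟨⟩ n))
    (ℚᵘ.*≡* (cong (λ m → (+ 1 ℤ.+ m) ℤ.* + 1) (ℤ.*-identityʳ (+ n)))))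

-- For ε = (a + 1)/d in lowest terms the denominator d serves as `n`, since ε d = a + 1.
archimedean : ∀ ε → 0ℚ ℚ.< ε → ∃[ n ] 1ℚ ℚ.≤ ε ℚ.* ⟨ n ⟩
archimedean ε@(mkℚ +[1+ a ] d-1 _) _ = suc d-1 , ℚ.toℚᵘ-cancel-≤
  (ℚᵘ.≤-respʳ-≃
    (ℚᵘ.≃-sym (ℚᵘ.≃-trans (ℚ.toℚᵘ-homo-* ε ⟨ suc d-1 ⟩)
      (ℚᵘ.*-congˡ {ℚ.toℚᵘ ε} (toℚᵘ-⟨⟩ (suc d-1)))))
    (ℚᵘ.*≤* (subst₂ ℤ._≤_ refl (sym (ℤ.*-identityʳ _))
      (+≤+ (subst (ℕ._≤ suc a ℕ.* suc d-1)
         (sym (trans (ℕ.+-identityʳ _) (ℕ.*-identityʳ (suc d-1))))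
         (ℕ.m≤n*m (suc d-1) (suc a)))))))
archimedean (mkℚ (+ 0) _ _) (ℚ.*<* (ℤ.+<+ ()))
archimedean (mkℚ ℤ.-[1+ _ ] _ _) (ℚ.*<* ())

-- Powers and Bernoulli-type inequalities

^-nonneg : ∀ {p} → 0ℚ ℚ.≤ p → ∀ n → 0ℚ ℚ.≤ p ^ n
^-nonneg 0≤p zero = 0≤1
^-nonneg 0≤p (suc n) = *-nonneg 0≤p (^-nonneg 0≤p n)

-- Each induction step leaves the surplus n y². Negative `y` is allowed, so the bound serves powers
-- of both 1 + x and 1 - x.
bernoulli : ∀ y → 0ℚ ℚ.≤ 1ℚ ℚ.+ y → ∀ n → 1ℚ ℚ.+ ⟨ n ⟩ ℚ.* y ℚ.≤ (1ℚ ℚ.+ y) ^ n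
bernoulli y _ zero = ℚ.≤-reflexive (trans (cong (1ℚ ℚ.+_) (ℚ.*-zeroˡ y)) (ℚ.+-identityʳ 1ℚ))
bernoulli y 0≤1+y (suc n) = ℚ.≤-trans
  (≤-by (⟨ n ⟩ ℚ.* (y ℚ.* y)) (*-nonneg 0≤⟨ n ⟩ (p*p-nonneg y))
    (solve 2 (λ n y → (con 1ℚ :+ y) :* (con 1ℚ :+ n :* y)
      := con 1ℚ :+ (con 1ℚ :+ n) :* y :+ n :* (y :* y)) refl ⟨ n ⟩ y))
  (*-monoˡ-≤ (1ℚ ℚ.+ y) 0≤1+y (bernoulli y 0≤1+y n))

-- Factors are paired as (1 + x)(1 - x) = 1 - x² until only one kind is left.
two-sided-bernoulli : ∀ x → 0ℚ ℚ.≤ x → x ℚ.≤ 1ℚ → ∀ i j →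
  0ℚ ℚ.≤ 1ℚ ℚ.+ (⟨ i ⟩ ℚ.- ⟨ j ⟩) ℚ.* x →
  (1ℚ ℚ.- ⟨ i ⟩ ℚ.* (x ℚ.* x)) ℚ.* (1ℚ ℚ.+ (⟨ i ⟩ ℚ.- ⟨ j ⟩) ℚ.* x)
    ℚ.≤ (1ℚ ℚ.+ x) ^ i ℚ.* (1ℚ ℚ.- x) ^ j
two-sided-bernoulli x 0≤x x≤1 zero j _ =
  ℚ.≤-trans
    (ℚ.≤-reflexive (solve 2 (λ j x →
      (con 1ℚ :- con 0ℚ :* (x :* x)) :* (con 1ℚ :+ (con 0ℚ :- j) :* x)
        := con 1ℚ :+ j :* (:- x)) refl ⟨ j ⟩ x))
    (ℚ.≤-trans (bernoulli (ℚ.- x) (p≤q⇒0≤q-p x≤1) j)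
      (ℚ.≤-reflexive (sym (ℚ.*-identityˡ _))))
two-sided-bernoulli x 0≤x x≤1 (suc i) zero 0≤ =
  ℚ.≤-trans
    (≤-by (⟨ suc i ⟩ ℚ.* (x ℚ.* x) ℚ.* (1ℚ ℚ.+ (⟨ suc i ⟩ ℚ.- 0ℚ) ℚ.* x))
      (*-nonneg (*-nonneg 0≤⟨ suc i ⟩ (p*p-nonneg x)) 0≤)
      (solve 2 (λ i x → con 1ℚ :+ i :* x :=
        (con 1ℚ :- i :* (x :* x)) :* (con 1ℚ :+ (i :- con 0ℚ) :* x)
          :+ i :* (x :* x) :* (con 1ℚ :+ (i :- con 0ℚ) :* x)) refl ⟨ suc i ⟩ x))
    (ℚ.≤-trans (bernoulli x (ℚ.+-mono-≤ 0≤1 0≤x) (suc i))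
      (ℚ.≤-reflexive (sym (ℚ.*-identityʳ _))))
two-sided-bernoulli x 0≤x x≤1 (suc i) (suc j) 0≤ = ℚ.≤-trans
  -- Multiplying (1 - x²)(1 - i x²) out leaves the surplus i x⁴, while `t` depends only on i - j and
  -- is unchanged.
  (≤-by (⟨ i ⟩ ℚ.* (x ℚ.* x ℚ.* (x ℚ.* x)) ℚ.* t) (*-nonneg (*-nonneg 0≤⟨ i ⟩ (p*p-nonneg (x ℚ.* x))) 0≤t)
    (solve 3 (λ i j x →
      (con 1ℚ :+ x) :* (con 1ℚ :- x)
        :* ((con 1ℚ :- i :* (x :* x)) :* (con 1ℚ :+ (i :- j) :* x))
      := (con 1ℚ :- (con 1ℚ :+ i) :* (x :* x))
           :* (con 1ℚ :+ (con 1ℚ :+ i :- (con 1ℚ :+ j)) :* x)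
         :+ i :* (x :* x :* (x :* x)) :* (con 1ℚ :+ (i :- j) :* x)) refl ⟨ i ⟩ ⟨ j ⟩ x))
  (ℚ.≤-trans
    (*-monoˡ-≤ ((1ℚ ℚ.+ x) ℚ.* (1ℚ ℚ.- x))
      (*-nonneg (ℚ.+-mono-≤ 0≤1 0≤x) (p≤q⇒0≤q-p x≤1))
      (two-sided-bernoulli x 0≤x x≤1 i j 0≤t))
    (ℚ.≤-reflexive (solve 4 (λ a b c d → a :* b :* (c :* d) := a :* c :* (b :* d)) refl
      (1ℚ ℚ.+ x) (1ℚ ℚ.- x) ((1ℚ ℚ.+ x) ^ i) ((1ℚ ℚ.- x) ^ j))))
  where
  t = 1ℚ ℚ.+ (⟨ i ⟩ ℚ.- ⟨ j ⟩) ℚ.* x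
  0≤t : 0ℚ ℚ.≤ t
  0≤t = subst (0ℚ ℚ.≤_) (solve 3 (λ i j x →
    con 1ℚ :+ (con 1ℚ :+ i :- (con 1ℚ :+ j)) :* x := con 1ℚ :+ (i :- j) :* x)
    refl ⟨ i ⟩ ⟨ j ⟩ x) 0≤

-- Here x = 1/k, so 1 + (i - j) x = 2 i x.
binomial-weight-bound : ∀ x i j → 0ℚ ℚ.≤ x → x ℚ.≤ 1ℚ → ⟨ i ℕ.+ j ⟩ ℚ.* x ≡ 1ℚ →
  (1ℚ ℚ.- x) ℚ.* ((1ℚ ℚ.+ 1ℚ) ℚ.* (⟨ i ⟩ ℚ.* x)) ℚ.≤ (1ℚ ℚ.+ x) ^ i ℚ.* (1ℚ ℚ.- x) ^ j
binomial-weight-bound x i j 0≤x x≤1 kx≡1 = ℚ.≤-trans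
  (≤-by (⟨ j ⟩ ℚ.* (x ℚ.* x) ℚ.* s) (*-nonneg (*-nonneg 0≤⟨ j ⟩ (p*p-nonneg x)) 0≤s)
    eq)
  (two-sided-bernoulli x 0≤x x≤1 i j (subst (0ℚ ℚ.≤_) (sym t≡s) 0≤s))
  where
  I = ⟨ i ⟩
  J = ⟨ j ⟩
  s = (1ℚ ℚ.+ 1ℚ) ℚ.* (I ℚ.* x)
  0≤s : 0ℚ ℚ.≤ s
  0≤s = *-nonneg (ℚ.+-mono-≤ 0≤1 0≤1) (*-nonneg 0≤⟨ i ⟩ 0≤x)
  1≡ : (I ℚ.+ J) ℚ.* x ≡ 1ℚ
  1≡ = trans (cong (ℚ._* x) (sym (⟨⟩-homo-+ i j))) kx≡1
  t≡s : 1ℚ ℚ.+ (I ℚ.- J) ℚ.* x ≡ s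
  t≡s = trans (cong (ℚ._+ (I ℚ.- J) ℚ.* x) (sym 1≡))
    (solve 3 (λ i j x → (i :+ j) :* x :+ (i :- j) :* x := (con 1ℚ :+ con 1ℚ) :* (i :* x)) refl I J x)
  -- As (i + j) x = 1, the factor 1 - i x² equals 1 - x + j x², and the last summand is the surplus.
  eq : (1ℚ ℚ.- I ℚ.* (x ℚ.* x)) ℚ.* (1ℚ ℚ.+ (I ℚ.- J) ℚ.* x) ≡ (1ℚ ℚ.- x) ℚ.* s ℚ.+ J ℚ.* (x ℚ.* x) ℚ.* s
  eq = trans (cong ((1ℚ ℚ.- I ℚ.* (x ℚ.* x)) ℚ.*_) t≡s)
    (trans (solve 4 (λ i j x s → (con 1ℚ :- i :* (x :* x)) :* s :=
        (con 1ℚ :- ((i :+ j) :* x) :* x) :* s :+ j :* (x :* x) :* s) refl I J x s)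
      (cong (λ u → (1ℚ ℚ.- u) ℚ.* s ℚ.+ J ℚ.* (x ℚ.* x) ℚ.* s)
        (trans (cong (ℚ._* x) 1≡) (ℚ.*-identityˡ x))))

recip : ∀ n → Σ[ x ∈ ℚ ] (0ℚ ℚ.≤ x × x ℚ.≤ 1ℚ × ⟨ suc n ⟩ ℚ.* x ≡ 1ℚ)
recip n = x , ℚ.<⇒≤ 0<x , x≤1 , kx≡1
  where
  instance
    k-pos : ℚ.Positive ⟨ suc n ⟩
    k-pos = ℚ.positive (ℚ.+-mono-<-≤ (ℚ.positive⁻¹ 1ℚ) 0≤⟨ n ⟩)
    k-nz : ℚ.NonZero ⟨ suc n ⟩
    k-nz = ℚ.pos⇒nonZero ⟨ suc n ⟩
  x = ℚ.1/ ⟨ suc n ⟩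
  0<x : 0ℚ ℚ.< x
  0<x = ℚ.positive⁻¹ x {{ℚ.1/pos⇒pos ⟨ suc n ⟩}}
  kx≡1 : ⟨ suc n ⟩ ℚ.* x ≡ 1ℚ
  kx≡1 = ℚ.*-inverseʳ ⟨ suc n ⟩
  x≤1 : x ℚ.≤ 1ℚ
  x≤1 = ≤-by (⟨ n ⟩ ℚ.* x) (*-nonneg 0≤⟨ n ⟩ (ℚ.<⇒≤ 0<x))
    (trans (sym kx≡1) (solve 2 (λ n x → (con 1ℚ :+ n) :* x := x :+ n :* x) refl ⟨ n ⟩ x))

-- Order on the reals

0<½ε : ∀ {ε} → 0ℚ ℚ.< ε → 0ℚ ℚ.< ½ ℚ.* ε
0<½ε = *-pos (ℚ.positive⁻¹ ½)

-- Ring identities between reals hold termwise, so only order and limits need ε's. Conversion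
-- between reals that differ syntactically makes Agda unfold their Cauchy moduli; hence identities
-- are stated at a term n, and steps that look definitional are spelled out as termwise refl.
infix 4 _≐_
record _≐_ (x y : ℝ) : Set where
  constructor termwise
  field at : ∀ n → seq x n ≡ seq y n
open _≐_

≐-refl : ∀ {x} → x ≐ x
≐-refl = termwise λ _ → refl

≐-reflexive : ∀ {x y} → x ≡ y → x ≐ y
≐-reflexive refl = ≐-refl

≤-refl : ∀ x → x ≤ x
≤-refl x ε 0<ε = 0 , λ n _ → subst (ℚ._< seq x n ℚ.+ ε) (ℚ.+-identityʳ (seq x n)) (ℚ.+-monoʳ-< (seq x n) 0<ε)

≐-sym : ∀ {x y} → x ≐ y → y ≐ x
≐-sym p = termwise λ n → sym (at p n)

≐-trans : ∀ {x y z} → x ≐ y → y ≐ z → x ≐ z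
≐-trans p q = termwise λ n → trans (at p n) (at q n)

≐⇒≤ : ∀ {x y} → x ≐ y → x ≤ y
≐⇒≤ {x} {y} p ε 0<ε = 0 , λ n _ →
  subst₂ ℚ._<_ (trans (ℚ.+-identityʳ (seq y n)) (sym (at p n))) refl (ℚ.+-monoʳ-< (seq y n) 0<ε)

∣p∣<ε⇒p<ε : ∀ {p ε} → ℚ.∣ p ∣ ℚ.< ε → p ℚ.< ε
∣p∣<ε⇒p<ε {p} = ℚ.≤-<-trans (p≤∣p∣ p)
  where
  p≤∣p∣ : ∀ p → p ℚ.≤ ℚ.∣ p ∣
  p≤∣p∣ p with ℚ.≤-total 0ℚ p
  ... | inj₁ 0≤p = ℚ.≤-reflexive (sym (ℚ.0≤p⇒∣p∣≡p 0≤p))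
  ... | inj₂ p≤0 = ℚ.≤-trans p≤0 (ℚ.0≤∣p∣ p)

p-q<ε⇒p<q+ε : ∀ {p q ε} → p ℚ.- q ℚ.< ε → p ℚ.< q ℚ.+ ε
p-q<ε⇒p<q+ε {p} {q} {ε} lt = subst (ℚ._< q ℚ.+ ε)
  (solve 2 (λ p q → q :+ (p :- q) := p) refl p q) (ℚ.+-monoʳ-< q lt)

≈⇒≤ : ∀ {x y} → x ≈ y → x ≤ y
≈⇒≤ x≈y ε 0<ε = let N , h = x≈y ε 0<ε in N , λ n N≤n → p-q<ε⇒p<q+ε (∣p∣<ε⇒p<ε (h n N≤n))

≈-sym : ∀ {x y} → x ≈ y → y ≈ x
≈-sym {x} {y} x≈y ε 0<ε = let N , h = x≈y ε 0<ε in N , λ n N≤n →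
  subst (ℚ._< ε) (trans (sym (ℚ.∣-p∣≡∣p∣ (seq x n ℚ.- seq y n)))
    (cong ℚ.∣_∣ (solve 2 (λ a b → :- (a :- b) := b :- a) refl (seq x n) (seq y n)))) (h n N≤n)

≈⇒≥ : ∀ {x y} → x ≈ y → y ≤ x
≈⇒≥ {x} {y} x≈y = ≈⇒≤ {y} {x} (≈-sym {x} {y} x≈y)

≐⇒≈ : ∀ {x y} → x ≐ y → x ≈ y
≐⇒≈ {x} {y} p ε 0<ε = 0 , λ n _ → subst (ℚ._< ε)
  (sym (cong ℚ.∣_∣ (trans (cong (ℚ._- seq y n) (at p n)) (ℚ.+-inverseʳ (seq y n))))) 0<ε

½ε+½ε : ∀ ε → ½ ℚ.* ε ℚ.+ ½ ℚ.* ε ≡ ε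
½ε+½ε = solve 1 (λ ε → con ½ :* ε :+ con ½ :* ε := ε) refl

≤-trans : ∀ {x y z} → x ≤ y → y ≤ z → x ≤ z
≤-trans {x} {y} {z} x≤y y≤z ε 0<ε =
  let M , hM = x≤y (½ ℚ.* ε) (0<½ε 0<ε)
      N , hN = y≤z (½ ℚ.* ε) (0<½ε 0<ε)
  in M ℕ.⊔ N , λ n le → ℚ.<-trans (hM n (ℕ.m⊔n≤o⇒m≤o M N le))
       (subst (seq y n ℚ.+ ½ ℚ.* ε ℚ.<_)
         (solve 2 (λ z ε → z :+ con ½ :* ε :+ con ½ :* ε := z :+ ε) refl (seq z n) ε)
         (ℚ.+-monoˡ-< (½ ℚ.* ε) (hN n (ℕ.m⊔n≤o⇒n≤o M N le))))

+-mono-≤ : ∀ {x x′ y y′} → x ≤ x′ → y ≤ y′ → x + y ≤ x′ + y′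
+-mono-≤ {x} {x′} {y} {y′} x≤x′ y≤y′ ε 0<ε =
  let M , hM = x≤x′ (½ ℚ.* ε) (0<½ε 0<ε)
      N , hN = y≤y′ (½ ℚ.* ε) (0<½ε 0<ε)
  in M ℕ.⊔ N , λ n le →
       subst (seq x n ℚ.+ seq y n ℚ.<_)
         (solve 3 (λ a b ε → (a :+ con ½ :* ε) :+ (b :+ con ½ :* ε) := (a :+ b) :+ ε)
           refl (seq x′ n) (seq y′ n) ε)
         (ℚ.+-mono-< (hM n (ℕ.m⊔n≤o⇒m≤o M N le)) (hN n (ℕ.m⊔n≤o⇒n≤o M N le)))

fromℚ-mono-≤ : ∀ {p q} → p ℚ.≤ q → fromℚ p ≤ fromℚ q
fromℚ-mono-≤ {p} {q} p≤q ε 0<ε = 0 , λ _ _ →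
  ℚ.≤-<-trans p≤q (subst (ℚ._< q ℚ.+ ε) (ℚ.+-identityʳ q) (ℚ.+-monoʳ-< q 0<ε))

scale-mono-≤ : ∀ {x y} q → 0ℚ ℚ.≤ q → x ≤ y → fromℚ q * x ≤ fromℚ q * y
scale-mono-≤ {x} {y} q 0≤q x≤y ε 0<ε =
  let N , h = x≤y δ 0<δ in N , λ n N≤n → ℚ.≤-<-trans
    (*-monoˡ-≤ q 0≤q (ℚ.<⇒≤ (h n N≤n)))
    (subst₂ ℚ._<_ (trans (ℚ.+-identityʳ _) (sym (ℚ.*-distribˡ-+ q (seq y n) δ)))
      (trans (ℚ.+-assoc (q ℚ.* seq y n) (q ℚ.* δ) δ) (cong (q ℚ.* seq y n ℚ.+_) qδ+δ≡ε))
      (ℚ.+-monoʳ-< (q ℚ.* seq y n ℚ.+ q ℚ.* δ) 0<δ))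
  where
  -- Dividing ε by 1 + q instead of q keeps the divisor positive when q = 0; the spare δ restores
  -- the strict inequality lost on multiplying by q.
  B = 1ℚ ℚ.+ q
  instance
    B-pos : ℚ.Positive B
    B-pos = ℚ.positive (ℚ.+-mono-<-≤ (ℚ.positive⁻¹ 1ℚ) 0≤q)
    B-nz : ℚ.NonZero B
    B-nz = ℚ.pos⇒nonZero B
  δ = ℚ.1/ B ℚ.* ε
  0<δ : 0ℚ ℚ.< δ
  0<δ = *-pos (ℚ.positive⁻¹ (ℚ.1/ B) {{ℚ.1/pos⇒pos B}}) 0<ε
  qδ+δ≡ε : q ℚ.* δ ℚ.+ δ ≡ ε
  qδ+δ≡ε = trans (solve 3 (λ q r e → q :* (r :* e) :+ r :* e := (con 1ℚ :+ q) :* r :* e) refl q (ℚ.1/ B) ε)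
    (trans (cong (ℚ._* ε) (ℚ.*-inverseʳ B)) (ℚ.*-identityˡ ε))

≤-preorder : Preorder 0ℓ 0ℓ 0ℓ
≤-preorder = record
  { Carrier = ℝ
  ; _≈_ = _≐_
  ; _≲_ = _≤_
  ; isPreorder = record
    { isEquivalence = record { refl = ≐-refl ; sym = ≐-sym ; trans = ≐-trans }
    ; reflexive = ≐⇒≤
    ; trans = λ {x} {y} {z} → ≤-trans {x} {y} {z}
    }
  }

open PreorderReasoning ≤-preorder

-- Here the factor is real rather than rational. Writing w q = w p + (q - p) w lets the nonnegative
-- rational q - p scale the inequality 0 ≤ w.
weight-mono-≤ : ∀ w {p q} → 0ℝ ≤ w → p ℚ.≤ q → w * fromℚ p ≤ w * fromℚ q
weight-mono-≤ w {p} {q} 0≤w p≤q = begin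
  w * fromℚ p                     ≈⟨ termwise (λ n → solve 3 (λ w p r → w :* p := w :* p :+ r :* con 0ℚ) refl (seq w n) p (q ℚ.- p)) ⟩
  w * fromℚ p + fromℚ (q ℚ.- p) * 0ℝ
    ≲⟨ +-mono-≤ {w * fromℚ p} {w * fromℚ p} {fromℚ (q ℚ.- p) * 0ℝ} {fromℚ (q ℚ.- p) * w}
        (≤-refl (w * fromℚ p)) (scale-mono-≤ {0ℝ} {w} (q ℚ.- p) (p≤q⇒0≤q-p p≤q) 0≤w) ⟩
  w * fromℚ p + fromℚ (q ℚ.- p) * w ≈⟨ termwise (λ n → solve 3 (λ w p q → w :* p :+ (q :- p) :* w := w :* q) refl (seq w n) p q) ⟩
  w * fromℚ q                     ∎

-- With 0 < δ < y eventually, l y < r y + η δ < (r + η) y, and y cancels.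
*-cancelʳ-≤ : ∀ {l r y} → 0ℝ < y → l * y ≤ r * y → l ≤ r
*-cancelʳ-≤ {l} {r} {y} (δ , 0<δ , M , hM) ly≤ry η 0<η =
  let N , hN = ly≤ry (η ℚ.* δ) (*-pos 0<η 0<δ)
  in M ℕ.⊔ N , λ n le →
    let δ<y = subst (ℚ._< seq y n) (ℚ.+-identityˡ δ) (hM n (ℕ.m⊔n≤o⇒m≤o M N le))
        0<y = ℚ.<-trans 0<δ δ<y
    in ℚ.*-cancelʳ-<-nonNeg (seq y n) {{ℚ.nonNegative (ℚ.<⇒≤ 0<y)}}
         (ℚ.<-trans (hN n (ℕ.m⊔n≤o⇒n≤o M N le))
           (subst (seq r n ℚ.* seq y n ℚ.+ η ℚ.* δ ℚ.<_)
             (sym (ℚ.*-distribʳ-+ (seq y n) (seq r n) η))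
             (ℚ.+-monoʳ-< (seq r n ℚ.* seq y n)
               (ℚ.*-monoʳ-<-pos η {{ℚ.positive 0<η}} δ<y))))

-- Sums over the cube

sumCube-cong : ∀ {k} (g h : Cube k → ℝ) → (∀ x → g x ≐ h x) → sumCube g ≐ sumCube h
sumCube-cong {zero}  g h e = e []
sumCube-cong {suc k} g h e = termwise λ n → cong₂ ℚ._+_
  (at (sumCube-cong (λ x → g (Sign.+ ∷ x)) (λ x → h (Sign.+ ∷ x)) λ x → e (Sign.+ ∷ x)) n)
  (at (sumCube-cong (λ x → g (Sign.- ∷ x)) (λ x → h (Sign.- ∷ x)) λ x → e (Sign.- ∷ x)) n)

sumCube-mono : ∀ {k} (g h : Cube k → ℝ) → (∀ x → g x ≤ h x) → sumCube g ≤ sumCube h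
sumCube-mono {zero}  g h e = e []
sumCube-mono {suc k} g h e = +-mono-≤
  {sumCube λ x → g (Sign.+ ∷ x)} {sumCube λ x → h (Sign.+ ∷ x)}
  {sumCube λ x → g (Sign.- ∷ x)} {sumCube λ x → h (Sign.- ∷ x)}
  (sumCube-mono (λ x → g (Sign.+ ∷ x)) (λ x → h (Sign.+ ∷ x)) λ x → e (Sign.+ ∷ x))
  (sumCube-mono (λ x → g (Sign.- ∷ x)) (λ x → h (Sign.- ∷ x)) λ x → e (Sign.- ∷ x))

sumCube-+ : ∀ {k} (g h : Cube k → ℝ) → sumCube (λ x → g x + h x) ≐ sumCube g + sumCube h
sumCube-+ {zero}  g h = termwise λ _ → refl
sumCube-+ {suc k} g h = termwise λ n → trans
  (cong₂ ℚ._+_ (at (sumCube-+ (λ x → g (Sign.+ ∷ x)) (λ x → h (Sign.+ ∷ x))) n)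
               (at (sumCube-+ (λ x → g (Sign.- ∷ x)) (λ x → h (Sign.- ∷ x))) n))
  (solve 4 (λ a b c d → (a :+ b) :+ (c :+ d) := (a :+ c) :+ (b :+ d)) refl
    (seq (sumCube λ x → g (Sign.+ ∷ x)) n) (seq (sumCube λ x → h (Sign.+ ∷ x)) n)
    (seq (sumCube λ x → g (Sign.- ∷ x)) n) (seq (sumCube λ x → h (Sign.- ∷ x)) n))

sumCube-* : ∀ {k} c (g : Cube k → ℝ) → sumCube (λ x → c * g x) ≐ c * sumCube g
sumCube-* {zero}  c g = termwise λ _ → refl
sumCube-* {suc k} c g = termwise λ n → trans
  (cong₂ ℚ._+_ (at (sumCube-* c (λ x → g (Sign.+ ∷ x))) n) (at (sumCube-* c (λ x → g (Sign.- ∷ x))) n))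
  (sym (ℚ.*-distribˡ-+ (seq c n) (seq (sumCube λ x → g (Sign.+ ∷ x)) n) (seq (sumCube λ x → g (Sign.- ∷ x)) n)))

sumCube-0 : ∀ {k} (g : Cube k → ℝ) → (∀ x → g x ≐ 0ℝ) → sumCube g ≐ 0ℝ
sumCube-0 {zero}  g g≐0 = g≐0 []
sumCube-0 {suc k} g g≐0 = termwise λ n → cong₂ ℚ._+_
  (at (sumCube-0 (λ x → g (Sign.+ ∷ x)) λ x → g≐0 (Sign.+ ∷ x)) n)
  (at (sumCube-0 (λ x → g (Sign.- ∷ x)) λ x → g≐0 (Sign.- ∷ x)) n)

sumCube-nonneg : ∀ {k} (g : Cube k → ℝ) → (∀ x → 0ℝ ≤ g x) → 0ℝ ≤ sumCube g
sumCube-nonneg {k} g 0≤g = begin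
  0ℝ                        ≈⟨ sumCube-0 {k} (λ _ → 0ℝ) (λ _ → ≐-refl) ⟨
  sumCube {k} (λ _ → 0ℝ)    ≲⟨ sumCube-mono (λ _ → 0ℝ) g 0≤g ⟩
  sumCube g                 ∎

𝔼-congʳ : ∀ {k} (w g h : Cube k → ℝ) → (∀ x → g x ≐ h x) → 𝔼 w g ≐ 𝔼 w h
𝔼-congʳ w g h e = sumCube-cong (λ x → w x * g x) (λ x → w x * h x)
  λ x → termwise λ n → cong (seq (w x) n ℚ.*_) (at (e x) n)

𝔼-0 : ∀ {k} (w g : Cube k → ℝ) → (∀ x → g x ≐ 0ℝ) → 𝔼 w g ≐ 0ℝ
𝔼-0 w g g≐0 = sumCube-0 (λ x → w x * g x)
  λ x → termwise λ n → trans (cong (seq (w x) n ℚ.*_) (at (g≐0 x) n)) (ℚ.*-zeroʳ (seq (w x) n))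

p+0≡p : ∀ {p q} → q ≡ 0ℚ → p ℚ.+ q ≡ p
p+0≡p {p} refl = ℚ.+-identityʳ p

0+q≡q : ∀ {p q} → p ≡ 0ℚ → p ℚ.+ q ≡ q
0+q≡q {q = q} refl = ℚ.+-identityˡ q

-- The predicate kAND

wt≤k : ∀ {k} (x : Cube k) → wt x ℕ.≤ k
wt≤k []           = z≤n
wt≤k (Sign.+ ∷ x) = s≤s (wt≤k x)
wt≤k (Sign.- ∷ x) = ℕ.m≤n⇒m≤1+n (wt≤k x)

-- With one coordinate -1 the weight is at most k. The membership test in a singleton computes to a
-- Boolean equality `∨ false`, which is what gets rewritten.
kAND-neg : ∀ {k} (x : Cube k) → f [ suc k ] (Sign.- ∷ x) ≡ 0ℝ
kAND-neg x = cong (λ b → if b ∨ false then 1ℝ else 0ℝ) (small (wt≤k x))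
  where
  small : ∀ {m n} → m ℕ.≤ n → (m ℕ.≡ᵇ suc n) ≡ false
  small z≤n       = refl
  small (s≤s m≤n) = small m≤n

-- Signs are their own inverses, so `a ⊙ b` is all-ones only for b = a. At each coordinate
-- `kAND-neg` kills the half-cube whose sign differs from that of `a`.
𝔼-f-point : ∀ {k} (g : Cube k → ℝ) a → 𝔼 g (λ b → f [ k ] (a ⊙ b)) ≐ g a
𝔼-f-point g [] = termwise λ n → ℚ.*-identityʳ (seq (g []) n)
𝔼-f-point {suc k} g (Sign.+ ∷ a) = termwise λ n → trans
  (p+0≡p (at (𝔼-0 (λ b → g (Sign.- ∷ b)) (λ b → f [ suc k ] ((Sign.+ ∷ a) ⊙ (Sign.- ∷ b)))
    λ b → ≐-reflexive (kAND-neg (a ⊙ b))) n))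
  (trans
    (at (𝔼-congʳ (λ b → g (Sign.+ ∷ b))
      (λ b → f [ suc k ] ((Sign.+ ∷ a) ⊙ (Sign.+ ∷ b))) (λ b → f [ k ] (a ⊙ b))
      λ b → ≐-refl) n)
    (at (𝔼-f-point (λ b → g (Sign.+ ∷ b)) a) n))
𝔼-f-point {suc k} g (Sign.- ∷ a) = termwise λ n → trans
  (0+q≡q (at (𝔼-0 (λ b → g (Sign.+ ∷ b)) (λ b → f [ suc k ] ((Sign.- ∷ a) ⊙ (Sign.+ ∷ b)))
    λ b → ≐-reflexive (kAND-neg (a ⊙ b))) n))
  (trans
    (at (𝔼-congʳ (λ b → g (Sign.- ∷ b))
      (λ b → f [ suc k ] ((Sign.- ∷ a) ⊙ (Sign.- ∷ b))) (λ b → f [ k ] (a ⊙ b))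
      λ b → ≐-refl) n)
    (at (𝔼-f-point (λ b → g (Sign.- ∷ b)) a) n))

ones : ∀ k → Cube k
ones k = replicate k Sign.+

ones-⊙ : ∀ {k} (x : Cube k) → ones k ⊙ x ≡ x
ones-⊙ []      = refl
ones-⊙ (s ∷ x) = cong (s ∷_) (ones-⊙ x)

𝔼-kAND : ∀ {k} (g : Cube k → ℝ) → 𝔼 g (f [ k ]) ≐ g (ones k)
𝔼-kAND {k} g = ≐-trans
  (𝔼-congʳ g (f [ k ]) (λ x → f [ k ] (ones k ⊙ x)) λ x → ≐-reflexive (cong (f [ k ]) (sym (ones-⊙ x))))
  (𝔼-f-point g (ones k))

𝔼-kNOR : ∀ {k} (g : Cube k → ℝ) → 𝔼 g (f [ 0 ]) ≐ g (replicate k Sign.-)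
𝔼-kNOR {zero}  g = termwise λ n → ℚ.*-identityʳ (seq (g []) n)
𝔼-kNOR {suc k} g = termwise λ n → trans
  (0+q≡q (at (𝔼-0 (λ x → g (Sign.+ ∷ x)) (λ x → f [ 0 ] (Sign.+ ∷ x)) λ _ → ≐-refl) n))
  (trans
    (at (𝔼-congʳ (λ x → g (Sign.- ∷ x)) (λ x → f [ 0 ] (Sign.- ∷ x)) (f [ 0 ]) λ _ → ≐-refl) n)
    (at (𝔼-kNOR λ x → g (Sign.- ∷ x)) n))

lam-kAND : ∀ {k} (D : Δ k) p → lam [ k ] D p ≐ 𝔼 (mass D) (bern p)
lam-kAND {k} D p = 𝔼-congʳ (mass D) (λ a → 𝔼 (bern p) λ b → f [ k ] (a ⊙ b)) (bern p) (𝔼-f-point (bern p))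

-- Bern(1)^k is the point mass at the all-ones vector.
𝔼-bern-1 : ∀ {k} (g : Cube k → ℝ) → 𝔼 g (bern 1ℝ) ≐ g (ones k)
𝔼-bern-1 {zero}  g = termwise λ n → ℚ.*-identityʳ (seq (g []) n)
𝔼-bern-1 {suc k} g = termwise λ n → trans
  (p+0≡p (at (𝔼-0 (λ x → g (Sign.- ∷ x)) (λ x → bern 1ℝ (Sign.- ∷ x))
    λ x → termwise λ m → ℚ.*-zeroˡ (seq (bern 1ℝ x) m)) n))
  (trans
    (at (𝔼-congʳ (λ x → g (Sign.+ ∷ x)) (λ x → bern 1ℝ (Sign.+ ∷ x)) (bern 1ℝ)
      λ x → termwise λ m → ℚ.*-identityˡ (seq (bern 1ℝ x) m)) n)
    (at (𝔼-bern-1 λ x → g (Sign.+ ∷ x)) n))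

γ-kAND : ∀ {k} (D : Δ k) → γ [ k ] D ≐ mass D (ones k)
γ-kAND D = ≐-trans (lam-kAND D 1ℝ) (𝔼-bern-1 (mass D))

-- Symmetric distributions and the lower bound on λ

wtℝ : ∀ {k} → Cube k → ℝ
wtℝ x = fromℚ ⟨ wt x ⟩

-- The quantity A of the overview. It takes a bare function, not a `Δ`, so that induction can pass
-- to a marginal.
plusMass : ∀ {k} → (Cube (suc k) → ℝ) → ℝ
plusMass w = sumCube λ y → w (Sign.+ ∷ y)

-- By induction on k: E[wt] = A + E_v[wt], where v is the marginal of w on the other coordinates;
-- swapping the first two coordinates shows that v has the same A.
plusMass-wt : ∀ {k} (w : Cube (suc k) → ℝ) → (∀ x y → wt x ≡ wt y → w x ≤ w y) →
  fromℚ ⟨ suc k ⟩ * plusMass w ≤ 𝔼 w wtℝ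
plusMass-wt {zero} w w-sym = ≐⇒≤ {fromℚ ⟨ 1 ⟩ * plusMass w} {𝔼 w wtℝ} (termwise λ n →
  solve 2 (λ a b → con 1ℚ :* a := a :* con 1ℚ :+ b :* con 0ℚ) refl
    (seq (w (Sign.+ ∷ [])) n) (seq (w (Sign.- ∷ [])) n))
plusMass-wt {suc k} w w-sym = begin
  fromℚ ⟨ suc (suc k) ⟩ * plusMass w
    ≈⟨ termwise (λ n → solve 2 (λ c a → (con 1ℚ :+ c) :* a := a :+ c :* a) refl ⟨ suc k ⟩ (seq (plusMass w) n)) ⟩
  plusMass w + fromℚ ⟨ suc k ⟩ * plusMass w
    ≲⟨ +-mono-≤ {plusMass w} {plusMass w} {fromℚ ⟨ suc k ⟩ * plusMass w} {fromℚ ⟨ suc k ⟩ * plusMass v}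
         (≤-refl (plusMass w)) (scale-mono-≤ {plusMass w} {plusMass v} ⟨ suc k ⟩ 0≤⟨ suc k ⟩ w≤v) ⟩
  plusMass w + fromℚ ⟨ suc k ⟩ * plusMass v
    ≲⟨ +-mono-≤ {plusMass w} {plusMass w} {fromℚ ⟨ suc k ⟩ * plusMass v} {𝔼 v wtℝ}
         (≤-refl (plusMass w)) (plusMass-wt v v-sym) ⟩
  plusMass w + 𝔼 v wtℝ
    ≈⟨ termwise split ⟩
  𝔼 w wtℝ ∎
  where
  w₊ w₋ v : Cube (suc k) → ℝ
  w₊ y = w (Sign.+ ∷ y)
  w₋ y = w (Sign.- ∷ y)
  v y = w₊ y + w₋ y

  v-sym : ∀ x y → wt x ≡ wt y → v x ≤ v y
  v-sym x y eq = +-mono-≤ {w₊ x} {w₊ y} {w₋ x} {w₋ y}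
    (w-sym (Sign.+ ∷ x) (Sign.+ ∷ y) (cong suc eq)) (w-sym (Sign.- ∷ x) (Sign.- ∷ y) eq)

  w≤v : plusMass w ≤ plusMass v
  w≤v = begin
    sumCube (λ z → w (Sign.+ ∷ Sign.+ ∷ z)) + sumCube (λ z → w (Sign.+ ∷ Sign.- ∷ z))
      ≈⟨ sumCube-+ (λ z → w (Sign.+ ∷ Sign.+ ∷ z)) (λ z → w (Sign.+ ∷ Sign.- ∷ z)) ⟨
    sumCube (λ z → w (Sign.+ ∷ Sign.+ ∷ z) + w (Sign.+ ∷ Sign.- ∷ z))
      ≲⟨ sumCube-mono (λ z → w (Sign.+ ∷ Sign.+ ∷ z) + w (Sign.+ ∷ Sign.- ∷ z)) (λ z → v (Sign.+ ∷ z))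
           (λ z → +-mono-≤ {w (Sign.+ ∷ Sign.+ ∷ z)} {w (Sign.+ ∷ Sign.+ ∷ z)}
                           {w (Sign.+ ∷ Sign.- ∷ z)} {w (Sign.- ∷ Sign.+ ∷ z)}
                    (≤-refl (w (Sign.+ ∷ Sign.+ ∷ z)))
                    -- Swapping the first two coordinates preserves the weight.
                    (w-sym (Sign.+ ∷ Sign.- ∷ z) (Sign.- ∷ Sign.+ ∷ z) refl)) ⟩
    plusMass v ∎

  -- On the half with first coordinate 1 the weight is one more than that of the tail; these extra
  -- ones sum to `plusMass w`.
  split : ∀ n → seq (plusMass w + 𝔼 v wtℝ) n ≡ seq (𝔼 w wtℝ) n
  split n = trans
    (cong (seq (plusMass w) n ℚ.+_) (trans
      (at (sumCube-cong (λ y → v y * wtℝ y) (λ y → w₊ y * wtℝ y + w₋ y * wtℝ y)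
        λ y → termwise λ m → ℚ.*-distribʳ-+ ⟨ wt y ⟩ (seq (w₊ y) m) (seq (w₋ y) m)) n)
      (at (sumCube-+ (λ y → w₊ y * wtℝ y) (λ y → w₋ y * wtℝ y)) n)))
    (trans (sym (ℚ.+-assoc (seq (plusMass w) n) (seq (𝔼 w₊ wtℝ) n) (seq (𝔼 w₋ wtℝ) n)))
      (cong₂ ℚ._+_
        (trans
          (sym (at (sumCube-+ w₊ (λ y → w₊ y * wtℝ y)) n))
          (at (sumCube-cong (λ y → w₊ y + w₊ y * wtℝ y) (λ y → w (Sign.+ ∷ y) * wtℝ (Sign.+ ∷ y))
            λ y → termwise λ m → solve 2 (λ a c → a :+ a :* c := a :* (con 1ℚ :+ c)) refl
              (seq (w₊ y) m) ⟨ wt y ⟩) n))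
        (at (sumCube-cong (λ y → w₋ y * wtℝ y) (λ y → w (Sign.- ∷ y) * wtℝ (Sign.- ∷ y))
          λ y → termwise λ _ → refl) n)))

ones≤sumCube : ∀ {k} (g : Cube k → ℝ) → (∀ x → 0ℝ ≤ g x) → g (ones k) ≤ sumCube g
ones≤sumCube {zero}  g 0≤g = ≤-refl (g [])
ones≤sumCube {suc k} g 0≤g = begin
  g (ones (suc k))
    ≈⟨ termwise (λ n → ℚ.+-identityʳ (seq (g (ones (suc k))) n)) ⟨
  g (ones (suc k)) + 0ℝ
    ≲⟨ +-mono-≤ {g (ones (suc k))} {sumCube λ x → g (Sign.+ ∷ x)} {0ℝ} {sumCube λ x → g (Sign.- ∷ x)}
         (ones≤sumCube (λ x → g (Sign.+ ∷ x)) λ x → 0≤g (Sign.+ ∷ x))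
         (sumCube-nonneg (λ x → g (Sign.- ∷ x)) λ x → 0≤g (Sign.- ∷ x)) ⟩
  sumCube (λ x → g (Sign.+ ∷ x)) + sumCube (λ x → g (Sign.- ∷ x)) ∎

-- This is A - (T - A) with T the total mass. T is kept because a distribution has T = 1 only up to
-- `_≈_`, not termwise.
sumCube-split : ∀ {k} (w : Cube (suc k) → ℝ) n →
  seq (𝔼 w (λ x → sgn (head x))) n ≡ seq (plusMass w) n ℚ.+ seq (plusMass w) n ℚ.- seq (sumCube w) n
sumCube-split w n = trans
  (cong₂ ℚ._+_
    (at (sumCube-cong (λ y → w (Sign.+ ∷ y) * sgn (head (Sign.+ ∷ y))) (λ y → w (Sign.+ ∷ y))
      λ y → termwise λ m → ℚ.*-identityʳ (seq (w (Sign.+ ∷ y)) m)) n)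
    (trans
      (at (sumCube-cong (λ y → w (Sign.- ∷ y) * sgn (head (Sign.- ∷ y))) (λ y → (- 1ℝ) * w (Sign.- ∷ y))
        λ y → termwise λ m → ℚ.*-comm (seq (w (Sign.- ∷ y)) m) (ℚ.- 1ℚ)) n)
      (at (sumCube-* (- 1ℝ) (λ y → w (Sign.- ∷ y))) n)))
  (solve 2 (λ a b → a :+ (:- con 1ℚ) :* b := a :+ a :- (a :+ b)) refl
    (seq (plusMass w) n) (seq (sumCube λ y → w (Sign.- ∷ y)) n))

-- Solving `sumCube-split` for A gives A = (T + μ)/2, and both totals are 1 up to `_≈_`.
plusMass-mono : ∀ {k} (D D′ : Δ (suc k)) → μ D ≤ μ D′ → plusMass (mass D) ≤ plusMass (mass D′)
plusMass-mono D D′ μ≤μ′ = begin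
  plusMass (mass D)
    ≈⟨ half D ⟨
  fromℚ ½ * (sumCube (mass D) + μ D)
    ≲⟨ scale-mono-≤ {sumCube (mass D) + μ D} {sumCube (mass D′) + μ D′} ½ (ℚ.nonNegative⁻¹ ½)
         (+-mono-≤ {sumCube (mass D)} {sumCube (mass D′)} {μ D} {μ D′}
           (≤-trans {sumCube (mass D)} {1ℝ} {sumCube (mass D′)}
             (≈⇒≤ {sumCube (mass D)} {1ℝ} (total D)) (≈⇒≥ {sumCube (mass D′)} {1ℝ} (total D′)))
           μ≤μ′) ⟩
  fromℚ ½ * (sumCube (mass D′) + μ D′)
    ≈⟨ half D′ ⟩
  plusMass (mass D′) ∎
  where
  half : ∀ D → fromℚ ½ * (sumCube (mass D) + μ D) ≐ plusMass (mass D)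
  half D = termwise λ n → trans
    (cong (λ m → ½ ℚ.* (seq (sumCube (mass D)) n ℚ.+ m)) (sumCube-split (mass D) n))
    (solve 2 (λ a t → con ½ :* (t :+ (a :+ a :- t)) := a) refl
      (seq (plusMass (mass D)) n) (seq (sumCube (mass D)) n))

-- `j` counts the coordinates -1; producing it together with its equation avoids truncated
-- subtraction.
bern-fromℚ : ∀ p {k} (a : Cube k) →
  ∃[ j ] (wt a ℕ.+ j ≡ k × bern (fromℚ p) a ≐ fromℚ (p ^ wt a ℚ.* (1ℚ ℚ.- p) ^ j))
bern-fromℚ p []           = 0 , refl , termwise λ _ → refl
bern-fromℚ p (Sign.+ ∷ a) = let j , eq , e = bern-fromℚ p a in
  j , cong suc eq , termwise λ n →
    trans (cong (p ℚ.*_) (at e n)) (sym (ℚ.*-assoc p (p ^ wt a) ((1ℚ ℚ.- p) ^ j)))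
bern-fromℚ p (Sign.- ∷ a) = let j , eq , e = bern-fromℚ p a in
  suc j , trans (ℕ.+-suc (wt a) j) (cong suc eq) , termwise λ n →
    trans (cong ((1ℚ ℚ.- p) ℚ.*_) (at e n))
      (solve 3 (λ p a b → (con 1ℚ :- p) :* (a :* b) := a :* ((con 1ℚ :- p) :* b)) refl
        p (p ^ wt a) ((1ℚ ℚ.- p) ^ j))

-- For p = (1 + x)/2 also 1 - p = (1 - x)/2, so every coordinate contributes a factor ½.
biased-weight : ∀ x i j →
  (½ ℚ.* (1ℚ ℚ.+ x)) ^ i ℚ.* (1ℚ ℚ.- ½ ℚ.* (1ℚ ℚ.+ x)) ^ j
    ≡ ½ ^ (i ℕ.+ j) ℚ.* ((1ℚ ℚ.+ x) ^ i ℚ.* (1ℚ ℚ.- x) ^ j)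
biased-weight x i j = trans
  (cong₂ ℚ._*_ (^-distrib-* ½ y i)
    (trans (cong (_^ j) (solve 1 (λ x → con 1ℚ :- con ½ :* (con 1ℚ :+ x) := con ½ :* (con 1ℚ :- x)) refl x))
      (^-distrib-* ½ z j)))
  (trans
    (solve 4 (λ a b c d → a :* b :* (c :* d) := (a :* c) :* (b :* d)) refl (½ ^ i) (y ^ i) (½ ^ j) (z ^ j))
    (cong (ℚ._* (y ^ i ℚ.* z ^ j)) (sym (^-homo-* ½ i j))))
  where
  y = 1ℚ ℚ.+ x
  z = 1ℚ ℚ.- x

biased-weight-bound : ∀ {x k} i j → 0ℚ ℚ.≤ x → x ℚ.≤ 1ℚ → ⟨ k ⟩ ℚ.* x ≡ 1ℚ → i ℕ.+ j ≡ k →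
  ½ ^ k ℚ.* ((1ℚ ℚ.- x) ℚ.* ((1ℚ ℚ.+ 1ℚ) ℚ.* (⟨ i ⟩ ℚ.* x)))
    ℚ.≤ (½ ℚ.* (1ℚ ℚ.+ x)) ^ i ℚ.* (1ℚ ℚ.- ½ ℚ.* (1ℚ ℚ.+ x)) ^ j
biased-weight-bound {x} {k} i j 0≤x x≤1 kx≡1 refl = ℚ.≤-trans
  (*-monoˡ-≤ (½ ^ k) (^-nonneg (ℚ.nonNegative⁻¹ ½) k) (binomial-weight-bound x i j 0≤x x≤1 kx≡1))
  (ℚ.≤-reflexive (sym (biased-weight x i j)))

-- Averaging a lower bound linear in the weight gives c E[wt], and symmetry of `D` bounds E[wt]
-- below by k A.
lam-≥-plusMass : ∀ {k} (D : Δ (suc k)) p c → 0ℚ ℚ.≤ c →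
  (∀ a → fromℚ c * (mass D a * wtℝ a) ≤ mass D a * bern p a) →
  fromℚ (c ℚ.* ⟨ suc k ⟩) * plusMass (mass D) ≤ lam [ suc k ] D p
lam-≥-plusMass {k} D p c 0≤c c≤ = begin
  fromℚ (c ℚ.* ⟨ suc k ⟩) * plusMass (mass D)
    ≈⟨ termwise (λ n → ℚ.*-assoc c ⟨ suc k ⟩ (seq (plusMass (mass D)) n)) ⟩
  fromℚ c * (fromℚ ⟨ suc k ⟩ * plusMass (mass D))
    ≲⟨ scale-mono-≤ {fromℚ ⟨ suc k ⟩ * plusMass (mass D)} {𝔼 (mass D) wtℝ} c 0≤c
         (plusMass-wt (mass D) λ a b eq → ≈⇒≤ {mass D a} {mass D b} (symmetric D a b eq)) ⟩
  fromℚ c * 𝔼 (mass D) wtℝ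
    ≈⟨ termwise (λ n → at (sumCube-* (fromℚ c) (λ a → mass D a * wtℝ a)) n) ⟨
  sumCube (λ a → fromℚ c * (mass D a * wtℝ a))
    ≲⟨ sumCube-mono (λ a → fromℚ c * (mass D a * wtℝ a)) (λ a → mass D a * bern p a) c≤ ⟩
  𝔼 (mass D) (bern p)
    ≈⟨ lam-kAND D p ⟨
  lam [ suc k ] D p ∎

biased : ℚ → ℝ
biased x = fromℚ (½ ℚ.* (1ℚ ℚ.+ x))

-- The pointwise hypothesis of `lam-≥-plusMass`, with c = (1 - x) 2^(1-k) x; multiplying c by k
-- cancels the last factor x.
biased-mass-bound : ∀ {x k} w (a : Cube k) → 0ℝ ≤ w → 0ℚ ℚ.≤ x → x ℚ.≤ 1ℚ → ⟨ k ⟩ ℚ.* x ≡ 1ℚ →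
  fromℚ ((1ℚ ℚ.- x) ℚ.* ((1ℚ ℚ.+ 1ℚ) ℚ.* ½ ^ k) ℚ.* x) * (w * wtℝ a) ≤ w * bern (biased x) a
biased-mass-bound {x} {k} w a 0≤w 0≤x x≤1 kx≡1 =
  let j , i+j≡k , e = bern-fromℚ (½ ℚ.* (1ℚ ℚ.+ x)) a in begin
  fromℚ ((1ℚ ℚ.- x) ℚ.* ((1ℚ ℚ.+ 1ℚ) ℚ.* ½ ^ k) ℚ.* x) * (w * wtℝ a)
    ≈⟨ termwise (λ n → solve 5 (λ z h x w i →
         z :* ((con 1ℚ :+ con 1ℚ) :* h) :* x :* (w :* i)
           := w :* (h :* (z :* ((con 1ℚ :+ con 1ℚ) :* (i :* x))))) refl
         (1ℚ ℚ.- x) (½ ^ k) x (seq w n) ⟨ wt a ⟩) ⟩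
  w * fromℚ (½ ^ k ℚ.* ((1ℚ ℚ.- x) ℚ.* ((1ℚ ℚ.+ 1ℚ) ℚ.* (⟨ wt a ⟩ ℚ.* x))))
    ≲⟨ weight-mono-≤ w 0≤w (biased-weight-bound (wt a) j 0≤x x≤1 kx≡1 i+j≡k) ⟩
  w * fromℚ ((½ ℚ.* (1ℚ ℚ.+ x)) ^ wt a ℚ.* (1ℚ ℚ.- ½ ℚ.* (1ℚ ℚ.+ x)) ^ j)
    ≈⟨ termwise (λ n → cong (seq w n ℚ.*_) (at e n)) ⟨
  w * bern (biased x) a ∎

2^k*½^k≡1 : ∀ k → (1ℚ ℚ.+ 1ℚ) ^ k ℚ.* ½ ^ k ≡ 1ℚ
2^k*½^k≡1 zero    = refl
2^k*½^k≡1 (suc k) = trans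
  (solve 2 (λ s h → (con 1ℚ :+ con 1ℚ) :* s :* (con ½ :* h) := s :* h) refl ((1ℚ ℚ.+ 1ℚ) ^ k) (½ ^ k))
  (2^k*½^k≡1 k)

-- The uniform distribution

sumCube-const : ∀ k → sumCube {k} (λ _ → fromℚ (½ ^ k)) ≐ 1ℝ
sumCube-const k = termwise λ n → trans (count k (½ ^ k) n) (2^k*½^k≡1 k)
  where
  -- The constant is generalised because the dimension drops in the induction while the exponent of
  -- ½ must stay fixed.
  count : ∀ m c n → seq (sumCube {m} (λ _ → fromℚ c)) n ≡ (1ℚ ℚ.+ 1ℚ) ^ m ℚ.* c
  count zero    c n = sym (ℚ.*-identityˡ c)
  count (suc m) c n = trans (cong₂ ℚ._+_ (count m c n) (count m c n))
    (solve 2 (λ s c → s :* c :+ s :* c := (con 1ℚ :+ con 1ℚ) :* s :* c) refl ((1ℚ ℚ.+ 1ℚ) ^ m) c)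

sumCube-bern : ∀ k p → sumCube {k} (bern p) ≐ 1ℝ
sumCube-bern zero    p = termwise λ _ → refl
sumCube-bern (suc k) p = termwise λ n → trans
  (cong₂ ℚ._+_
    (trans (at (sumCube-* {k} p (bern p)) n) (cong (seq p n ℚ.*_) (at (sumCube-bern k p) n)))
    (trans (at (sumCube-* {k} (1ℝ - p) (bern p)) n) (cong ((1ℚ ℚ.- seq p n) ℚ.*_) (at (sumCube-bern k p) n))))
  (solve 1 (λ p → p :* con 1ℚ :+ (con 1ℚ :- p) :* con 1ℚ := con 1ℚ) refl (seq p n))

uniform : ∀ k → Δ k
uniform k = record
  { mass      = λ _ → fromℚ (½ ^ k)
  ; nonneg    = λ _ → fromℚ-mono-≤ (^-nonneg (ℚ.nonNegative⁻¹ ½) k)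
  ; total     = ≐⇒≈ {sumCube {k} (λ _ → fromℚ (½ ^ k))} {1ℝ} (sumCube-const k)
  ; symmetric = λ x y _ → ≐⇒≈ {fromℚ (½ ^ k)} ≐-refl
  }

-- The constant mass factors out of the sum, and `bern p` sums to 1 for every real `p`.
lam-uniform : ∀ k p → lam [ k ] (uniform k) p ≐ fromℚ (½ ^ k)
lam-uniform k p = termwise λ n → trans (at (lam-kAND (uniform k) p) n)
  (trans (at (sumCube-cong {k} (λ a → mass (uniform k) a * bern p a) (λ a → fromℚ (½ ^ k) * bern p a)
    λ a → termwise λ _ → refl) n)
    (trans (at (sumCube-* {k} (fromℚ (½ ^ k)) (bern p)) n) (trans (cong (½ ^ k ℚ.*_) (at (sumCube-bern k p) n)) (ℚ.*-identityʳ (½ ^ k)))))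

beta-uniform : ∀ k → IsBeta [ k ] (uniform k) (fromℚ (½ ^ k))
beta-uniform k = upper , λ u u-upper → u-upper (fromℚ (½ ^ k))
  -- λ is constant in p, so any p attains the supremum; p = 0 is chosen.
  (0ℝ , ≤-refl 0ℝ , fromℚ-mono-≤ 0≤1 ,
   ≐⇒≈ {fromℚ (½ ^ k)} {lam [ k ] (uniform k) 0ℝ} (≐-sym (lam-uniform k 0ℝ)))
  where
  upper : ∀ x → ∃[ p ] (0ℝ ≤ p × p ≤ 1ℝ × x ≈ lam [ k ] (uniform k) p) → x ≤ fromℚ (½ ^ k)
  upper x (p , _ , _ , x≈) = begin
    x                          ≲⟨ ≈⇒≤ {x} {lam [ k ] (uniform k) p} x≈ ⟩
    lam [ k ] (uniform k) p    ≈⟨ lam-uniform k p ⟩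
    fromℚ (½ ^ k)              ∎

-- The uniform distribution on the two constant vectors (f [ 0 ] is the indicator of the all -1 vector)

f-ones : ∀ k → f [ k ] (ones k) ≡ 1ℝ
f-ones zero    = refl
f-ones (suc k) = f-ones k

½f-nonneg : ∀ S {k} (x : Cube k) → 0ℝ ≤ fromℚ ½ * f S x
½f-nonneg S x = go (does (_∈?_ ℕ._≟_ (wt x) S))
  where
  go : ∀ b → 0ℝ ≤ fromℚ ½ * (if b then 1ℝ else 0ℝ)
  go true  = fromℚ-mono-≤ (ℚ.nonNegative⁻¹ ½)
  go false = ≤-refl 0ℝ

-- Built from `f`, which sees only the weight, so symmetry is a congruence. For k = 0 the two atoms
-- coincide and their masses add up.
constantMass : ∀ k → Cube k → ℝ
constantMass k x = fromℚ ½ * f [ k ] x + fromℚ ½ * f [ 0 ] x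

constantMass-total : ∀ k → sumCube (constantMass k) ≐ 1ℝ
constantMass-total k = termwise λ n → trans
  (trans
    (at (sumCube-cong {k} (constantMass k) (λ x → fromℚ ½ * f [ k ] x + fromℚ ½ * f [ 0 ] x)
      λ _ → termwise λ _ → refl) n)
    (at (sumCube-+ {k} (λ x → fromℚ ½ * f [ k ] x) (λ x → fromℚ ½ * f [ 0 ] x)) n))
  (cong₂ ℚ._+_ (at (𝔼-kAND {k} (λ _ → fromℚ ½)) n) (at (𝔼-kNOR {k} (λ _ → fromℚ ½)) n))

constant : ∀ k → Δ k
constant k = record
  { mass      = constantMass k
  ; nonneg    = λ x → +-mono-≤ {0ℝ} {fromℚ ½ * f [ k ] x} {0ℝ} {fromℚ ½ * f [ 0 ] x}
                        (½f-nonneg [ k ] x) (½f-nonneg [ 0 ] x)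
  ; total     = ≐⇒≈ {sumCube (constantMass k)} {1ℝ} (constantMass-total k)
  ; symmetric = λ x y eq → ≐⇒≈ {constantMass k x} {constantMass k y} (termwise λ n → cong
      (λ i → ½ ℚ.* seq (if does (_∈?_ ℕ._≟_ i [ k ]) then 1ℝ else 0ℝ) n
         ℚ.+ ½ ℚ.* seq (if does (_∈?_ ℕ._≟_ i [ 0 ]) then 1ℝ else 0ℝ) n) eq)
  }

constantMass-plus : ∀ k → plusMass (constantMass (suc k)) ≐ fromℚ ½
constantMass-plus k = termwise λ n → trans
  (trans
    (at (sumCube-cong {k} (λ y → constantMass (suc k) (Sign.+ ∷ y))
      (λ y → fromℚ ½ * f [ suc k ] (Sign.+ ∷ y) + fromℚ ½ * f [ 0 ] (Sign.+ ∷ y))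
      λ _ → termwise λ _ → refl) n)
    (at (sumCube-+ {k} (λ y → fromℚ ½ * f [ suc k ] (Sign.+ ∷ y)) (λ y → fromℚ ½ * f [ 0 ] (Sign.+ ∷ y))) n))
  (cong₂ ℚ._+_
    (trans (at (𝔼-congʳ {k} (λ _ → fromℚ ½) (λ y → f [ suc k ] (Sign.+ ∷ y)) (f [ k ]) λ _ → termwise λ _ → refl) n)
      (at (𝔼-kAND {k} (λ _ → fromℚ ½)) n))
    (at (𝔼-0 {k} (λ _ → fromℚ ½) (λ y → f [ 0 ] (Sign.+ ∷ y)) λ _ → termwise λ _ → refl) n))

γ-constant : ∀ k → γ [ suc k ] (constant (suc k)) ≐ fromℚ ½
γ-constant k = termwise λ n → trans (at (γ-kAND (constant (suc k))) n)
  -- The second atom contributes 0 because the dimension is positive, so the all-ones vector has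
  -- nonzero weight.
  (cong (λ r → ½ ℚ.* seq r n ℚ.+ ½ ℚ.* 0ℚ) (f-ones (suc k)))

uniform-plus : ∀ k → plusMass {k} (λ _ → fromℚ (½ ^ suc k)) ≐ fromℚ ½
uniform-plus k = termwise λ n → trans
  (at (sumCube-cong {k} (λ _ → fromℚ (½ ^ suc k)) (λ _ → fromℚ ½ * fromℚ (½ ^ k)) λ _ → termwise λ _ → refl) n)
  (trans (at (sumCube-* {k} (fromℚ ½) (λ _ → fromℚ (½ ^ k))) n) (cong (½ ℚ.*_) (at (sumCube-const k) n)))

-- Both have A = ½ and total 1, so both means are 0.
μ-uniform≈μ-constant : ∀ k → μ (uniform (suc k)) ≈ μ (constant (suc k))
μ-uniform≈μ-constant k = ≐⇒≈ {μ (uniform (suc k))} {μ (constant (suc k))} (termwise λ n → trans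
  (trans (sumCube-split (mass (uniform (suc k))) n)
    (cong₂ (λ a t → a ℚ.+ a ℚ.- t) (at (uniform-plus k) n) (at (sumCube-const (suc k)) n)))
  (sym (trans (sumCube-split (mass (constant (suc k))) n)
    (cong₂ (λ a t → a ℚ.+ a ℚ.- t) (at (constantMass-plus k) n) (at (constantMass-total (suc k)) n)))))

-- Bounds on α

-- This is 2^(1-k), the value of 2ρ(kAND).
2½^_ : ℕ → ℚ
2½^ k = (1ℚ ℚ.+ 1ℚ) ℚ.* ½ ^ k

α-upper : ∀ k a → IsAlpha (suc k) [ suc k ] (fin a) → a ≤ fromℚ (2½^ suc k)
α-upper k a (a-lower , _) = a-lower (fin (fromℚ (2½^ suc k)))
  (uniform (suc k) , constant (suc k) , μ-uniform≈μ-constant k , fromℚ (½ ^ suc k) , beta-uniform (suc k) ,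
   -- The gap ¼ witnesses 0 < γ = ½; the quotient is then 2^(-k) / ½.
   (½ ℚ.* ½ , ℚ.positive⁻¹ (½ ℚ.* ½) , 0 , λ n _ →
     subst (0ℚ ℚ.+ ½ ℚ.* ½ ℚ.<_) (sym (at (γ-constant k) n)) (ℚ.*<* (ℤ.+<+ (s≤s (s≤s (s≤s z≤n)))))) ,
   ≐⇒≈ {fromℚ (2½^ suc k) * γ [ suc k ] (constant (suc k))} {fromℚ (½ ^ suc k)}
     (termwise λ n → trans (cong ((2½^ suc k) ℚ.*_) (at (γ-constant k) n))
       (solve 1 (λ h → (con 1ℚ :+ con 1ℚ) :* h :* con ½ := h) refl (½ ^ suc k))))

-- As `a` is the greatest lower bound, it suffices to bound each admissible quotient: infinite ones
-- trivially, finite ones after multiplying by γ(D_Y) > 0.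
α-lower : ∀ k a x → 0ℚ ℚ.≤ x → x ℚ.≤ 1ℚ → ⟨ suc k ⟩ ℚ.* x ≡ 1ℚ →
  IsAlpha (suc k) [ suc k ] (fin a) → fromℚ ((1ℚ ℚ.- x) ℚ.* (2½^ suc k)) ≤ a
α-lower k a x 0≤x x≤1 kx≡1 (_ , a-greatest) = a-greatest (fin (fromℚ L)) lower
  where
  L = (1ℚ ℚ.- x) ℚ.* (2½^ suc k)
  0≤L : 0ℚ ℚ.≤ L
  0≤L = *-nonneg (p≤q⇒0≤q-p x≤1)
    (*-nonneg (ℚ.+-mono-≤ 0≤1 0≤1) (^-nonneg (ℚ.nonNegative⁻¹ ½) (suc k)))
  p = biased x

  lower : ∀ r → (Σ[ DN ∈ Δ (suc k) ] Σ[ DY ∈ Δ (suc k) ] (μ DN ≈ μ DY ×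
    ∃[ b ] (IsBeta [ suc k ] DN b × IsQuotient b (γ [ suc k ] DY) r))) → fin (fromℚ L) ≤∞ r
  lower ∞       _ = _
  lower (fin r) (DN , DY , μ≈ , b , (b-upper , _) , 0<γ , rγ≈b) =
    *-cancelʳ-≤ {fromℚ L} {r} {γ [ suc k ] DY} 0<γ (begin
      fromℚ L * γ [ suc k ] DY
        ≲⟨ scale-mono-≤ {γ [ suc k ] DY} {plusMass (mass DN)} L 0≤L γ≤A ⟩
      fromℚ L * plusMass (mass DN)
        -- Inserting k x = 1 brings out the constant c = L x that `lam-≥-plusMass` multiplies by k.
        ≈⟨ termwise (λ n → cong (ℚ._* seq (plusMass (mass DN)) n) L≡) ⟩
      fromℚ (L ℚ.* x ℚ.* ⟨ suc k ⟩) * plusMass (mass DN)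
        ≲⟨ lam-≥-plusMass DN p (L ℚ.* x) (*-nonneg 0≤L 0≤x)
             (λ c → biased-mass-bound (mass DN c) c (nonneg DN c) 0≤x x≤1 kx≡1) ⟩
      lam [ suc k ] DN p
        ≲⟨ b-upper (lam [ suc k ] DN p) (p , fromℚ-mono-≤ 0≤p , fromℚ-mono-≤ p≤1 ,
             ≐⇒≈ {lam [ suc k ] DN p} {lam [ suc k ] DN p} ≐-refl) ⟩
      b
        ≲⟨ ≈⇒≥ {r * γ [ suc k ] DY} {b} rγ≈b ⟩
      r * γ [ suc k ] DY ∎)
    where
    0≤p : 0ℚ ℚ.≤ ½ ℚ.* (1ℚ ℚ.+ x)
    0≤p = *-nonneg (ℚ.nonNegative⁻¹ ½) (ℚ.+-mono-≤ 0≤1 0≤x)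
    p≤1 : ½ ℚ.* (1ℚ ℚ.+ x) ℚ.≤ 1ℚ
    p≤1 = *-monoˡ-≤ ½ (ℚ.nonNegative⁻¹ ½) (ℚ.+-monoʳ-≤ 1ℚ x≤1)
    L≡ : L ≡ L ℚ.* x ℚ.* ⟨ suc k ⟩
    L≡ = trans (sym (ℚ.*-identityʳ L)) (trans (cong (L ℚ.*_) (sym kx≡1))
      (solve 3 (λ l k x → l :* (k :* x) := l :* x :* k) refl L ⟨ suc k ⟩ x))
    γ≤A : γ [ suc k ] DY ≤ plusMass (mass DN)
    γ≤A = begin
      γ [ suc k ] DY         ≈⟨ γ-kAND DY ⟩
      mass DY (ones (suc k)) ≲⟨ ones≤sumCube (λ y → mass DY (Sign.+ ∷ y)) (λ y → nonneg DY (Sign.+ ∷ y)) ⟩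
      plusMass (mass DY)     ≲⟨ plusMass-mono DY DN (≈⇒≥ {μ DN} {μ DY} μ≈) ⟩
      plusMass (mass DN)     ∎

-- The quotient of α by 2ρ and its limit

½*recip : ∀ m .{{_ : ℕ.NonZero m}} → ½ ℚ.* (+ 1 ℚ./ m) ≡ (+ 1 ℚ./ (2 ℕ.* m)) {{ℕ.m*n≢0 2 m}}
-- Normalisation is stuck on a variable denominator, so the comparison is made between unnormalised
-- fractions.
½*recip m@(suc m-1) = ℚ.toℚᵘ-injective (ℚᵘ.≃-trans (ℚ.toℚᵘ-homo-* ½ (+ 1 ℚ./ m))
  (ℚᵘ.≃-trans (ℚᵘ.*-congˡ {ℚ.toℚᵘ ½} (ℚ.toℚᵘ-fromℚᵘ (ℚᵘ.mkℚᵘ (+ 1) m-1)))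
    (ℚᵘ.≃-sym (ℚ.toℚᵘ-fromℚᵘ (ℚᵘ.mkℚᵘ (+ 1) (m-1 ℕ.+ (m ℕ.+ 0)))))))

½^≡recip : ∀ k → ½ ^ k ≡ (+ 1 ℚ./ (2 ℕ.^ k)) {{ℕ.m^n≢0 2 k}}
½^≡recip zero    = refl
½^≡recip (suc k) = trans (cong (½ ℚ.*_) (½^≡recip k)) (½*recip (2 ℕ.^ k) {{ℕ.m^n≢0 2 k}})

ρ-kAND : ∀ k → ρ k [ k ] ≐ fromℚ (½ ^ k)
ρ-kAND k = termwise λ n → trans (at (𝔼-kAND {k} unif) n) (sym (½^≡recip k))

-- Division by 2ρ as multiplication by 2^(k-1); the form ½ · 2^k also covers k = 0.
scaled : (ℕ → ℝ) → ℕ → ℝ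
scaled α k = fromℚ (½ ℚ.* (1ℚ ℚ.+ 1ℚ) ^ k) * α k

scaled-2½^ : ∀ k z → ½ ℚ.* (1ℚ ℚ.+ 1ℚ) ^ k ℚ.* (z ℚ.* (2½^ k)) ≡ z
scaled-2½^ k z = trans
  (solve 3 (λ s h z → con ½ :* s :* (z :* ((con 1ℚ :+ con 1ℚ) :* h)) := z :* (s :* h)) refl
    ((1ℚ ℚ.+ 1ℚ) ^ k) (½ ^ k) z)
  (trans (cong (z ℚ.*_) (2^k*½^k≡1 k)) (ℚ.*-identityʳ z))

0<½^_ : ∀ k → 0ℚ ℚ.< ½ ^ k
0<½^ zero  = ℚ.positive⁻¹ 1ℚ
0<½^ suc k = 0<½ε (0<½^ k)

scaled-isQuotient : ∀ α k → IsQuotient (α k) (2ℝ * ρ k [ k ]) (fin (scaled α k))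
scaled-isQuotient α k =
  (½ ^ k , 0<½^ k , 0 , λ n _ → subst₂ ℚ._<_ (sym (ℚ.+-identityˡ (½ ^ k)))
    (sym (trans (cong ((1ℚ ℚ.+ 1ℚ) ℚ.*_) (at (ρ-kAND k) n))
      (solve 1 (λ h → (con 1ℚ :+ con 1ℚ) :* h := h :+ h) refl (½ ^ k))))
    (subst (ℚ._< ½ ^ k ℚ.+ ½ ^ k) (ℚ.+-identityʳ (½ ^ k)) (ℚ.+-monoʳ-< (½ ^ k) (0<½^ k)))) ,
  ≐⇒≈ {scaled α k * (2ℝ * ρ k [ k ])} {α k} (termwise λ n → trans
    (cong (λ r → ½ ℚ.* (1ℚ ℚ.+ 1ℚ) ^ k ℚ.* seq (α k) n ℚ.* ((1ℚ ℚ.+ 1ℚ) ℚ.* r)) (at (ρ-kAND k) n))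
    (trans (solve 3 (λ c a t → c :* a :* t := c :* (a :* t)) refl
        (½ ℚ.* (1ℚ ℚ.+ 1ℚ) ^ k) (seq (α k) n) (2½^ k))
      (scaled-2½^ k (seq (α k) n))))

recip-small : ∀ {δ x m n} → 0ℚ ℚ.≤ δ → 1ℚ ℚ.≤ δ ℚ.* ⟨ m ⟩ → m ℕ.≤ suc n →
  ⟨ suc n ⟩ ℚ.* x ≡ 1ℚ → x ℚ.≤ δ
recip-small {δ} {x} {m} {n} 0≤δ 1≤δm m≤n kx≡1 =
  ℚ.*-cancelʳ-≤-pos ⟨ suc n ⟩ {{ℚ.positive (ℚ.+-mono-<-≤ (ℚ.positive⁻¹ 1ℚ) 0≤⟨ n ⟩)}}
    (ℚ.≤-trans (ℚ.≤-reflexive (trans (ℚ.*-comm x ⟨ suc n ⟩) kx≡1))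
      (ℚ.≤-trans 1≤δm (*-monoˡ-≤ δ 0≤δ (⟨⟩-mono-≤ m≤n))))

p-q<ε : ∀ {p q ε} → p ℚ.< q ℚ.+ ε → p ℚ.- q ℚ.< ε
p-q<ε {p} {q} {ε} lt = subst (p ℚ.- q ℚ.<_)
  (solve 2 (λ q ε → q :+ ε :- q := ε) refl q ε) (ℚ.+-monoˡ-< (ℚ.- q) lt)

∣p-q∣<ε : ∀ {p q ε} → p ℚ.< q ℚ.+ ε → q ℚ.< p ℚ.+ ε → ℚ.∣ p ℚ.- q ∣ ℚ.< ε
∣p-q∣<ε {p} {q} {ε} p<q+ε q<p+ε with ℚ.∣p∣≡p∨∣p∣≡-p (p ℚ.- q)
... | inj₁ eq = subst (ℚ._< ε) (sym eq) (p-q<ε p<q+ε)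
... | inj₂ eq = subst (ℚ._< ε)
  (sym (trans eq (solve 2 (λ p q → :- (p :- q) := q :- p) refl p q))) (p-q<ε q<p+ε)

-- With η the gap in 0 < ε, half of η becomes the gap that `_<_` demands and the other half bounds
-- |y - 1|. For 1 < y + η/2 that half is shared equally by `x` and the slack in 1 - x ≤ y.
near-one : ∀ {y ε x} → (0<ε : 0ℝ < ε) → x ℚ.≤ ½ ℚ.* (½ ℚ.* proj₁ 0<ε) →
  fromℚ (1ℚ ℚ.- x) ≤ y → y ≤ 1ℝ → ∣ y - 1ℝ ∣ < ε
near-one {y} {ε} {x} (η , 0<η , M , hM) x≤δ 1-x≤y y≤1 =
  let δ      = ½ ℚ.* (½ ℚ.* η)
      N , hN = 1-x≤y δ (0<½ε (0<½ε 0<η))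
      P , hP = y≤1 (½ ℚ.* η) (0<½ε 0<η)
  in ½ ℚ.* η , 0<½ε 0<η , M ℕ.⊔ (N ℕ.⊔ P) , λ n le →
    let M≤n  = ℕ.m⊔n≤o⇒m≤o M (N ℕ.⊔ P) le
        NP≤n = ℕ.m⊔n≤o⇒n≤o M (N ℕ.⊔ P) le
        1<y  = subst₂ ℚ._<_
                 (solve 1 (λ x → con 1ℚ :- x :+ x := con 1ℚ) refl x)
                 (solve 2 (λ y η → y :+ con ½ :* (con ½ :* η) :+ con ½ :* (con ½ :* η) := y :+ con ½ :* η)
                   refl (seq y n) η)
                 (ℚ.+-mono-<-≤ (hN n (ℕ.m⊔n≤o⇒m≤o N P NP≤n)) x≤δ)
    in ℚ.<-trans
      (subst (ℚ.∣ seq y n ℚ.- 1ℚ ∣ ℚ.+ ½ ℚ.* η ℚ.<_) (½ε+½ε η)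
        (ℚ.+-monoˡ-< (½ ℚ.* η) (∣p-q∣<ε (hP n (ℕ.m⊔n≤o⇒n≤o N P NP≤n)) 1<y)))
      (subst (ℚ._< seq ε n) (ℚ.+-identityˡ η) (hM n M≤n))

scaled⟶1 : ∀ α → (∀ k → .{{_ : NonZero k}} → IsAlpha k [ k ] (fin (α k))) → scaled α ⟶ 1ℝ
scaled⟶1 α isα ε 0<ε =
  let δ     = ½ ℚ.* (½ ℚ.* proj₁ 0<ε)
      0<δ   = 0<½ε (0<½ε (proj₁ (proj₂ 0<ε)))
      m , h = archimedean δ 0<δ
  -- Taking `suc m` rather than `m` excludes k = 0, where nothing is assumed about α.
  in suc m , λ where
    (suc k) (s≤s m≤k) →
      let x , 0≤x , x≤1 , kx≡1 = recip k
          c = ½ ℚ.* (1ℚ ℚ.+ 1ℚ) ^ suc k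
          0≤c = *-nonneg (ℚ.nonNegative⁻¹ ½) (^-nonneg (ℚ.nonNegative⁻¹ (1ℚ ℚ.+ 1ℚ)) (suc k))
      in near-one {scaled α (suc k)} {ε} 0<ε
        (recip-small (ℚ.<⇒≤ 0<δ) h (ℕ.m≤n⇒m≤1+n m≤k) kx≡1)
        (begin
          fromℚ (1ℚ ℚ.- x)
            ≈⟨ termwise (λ _ → scaled-2½^ (suc k) (1ℚ ℚ.- x)) ⟨
          fromℚ c * fromℚ ((1ℚ ℚ.- x) ℚ.* (2½^ suc k))
            ≲⟨ scale-mono-≤ {fromℚ ((1ℚ ℚ.- x) ℚ.* (2½^ suc k))} {α (suc k)} c 0≤c
                 (α-lower k (α (suc k)) x 0≤x x≤1 kx≡1 (isα (suc k))) ⟩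
          fromℚ c * α (suc k) ∎)
        (begin
          fromℚ c * α (suc k)
            ≲⟨ scale-mono-≤ {α (suc k)} {fromℚ (2½^ suc k)} c 0≤c (α-upper k (α (suc k)) (isα (suc k))) ⟩
          fromℚ c * fromℚ (2½^ suc k)
            ≈⟨ termwise (λ _ → trans (cong (c ℚ.*_) (sym (ℚ.*-identityˡ (2½^ suc k)))) (scaled-2½^ (suc k) 1ℚ)) ⟩
          1ℝ ∎)

corollary1p3 : (α : ℕ → ℝ) →
    (∀ k → .{{_ : NonZero k}} → IsAlpha k [ k ] (fin (α k))) →
    ∃[ q ] ((∀ k → .{{_ : NonZero k}} → IsQuotient (α k) (2ℝ * ρ k [ k ]) (fin (q k))) × (q ⟶ 1ℝ))
corollary1p3 α isα = scaled α , (λ k → scaled-isQuotient α k) , scaled⟶1 α isα
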